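{- Let $p$ be a large prime, let $k$ be a positive integer, let $N$ be a positive integer with $N<p$, let $I=[1,N]$, and let $\mathcal{P}$ be the set of prime numbers. Then the number $J_{2k}$ of solutions of the congruence $$x_1^*+\dots+x_k^*\equiv x_{k+1}^*+\dots+x_{2k}^*\pmod p,\qquad x_1,\dots,x_{2k}\in I\cap\mathcal{P},$$ satisfies $$J_{2k}<(2k)^{k}\left(\frac{N^{2k-1}}{p}+1\right)N^{k}.$$
   Context: $[1,N]$ denotes the set of integers $1,\dots,N$. For an integer $x$ coprime to $p$, $x^*$ denotes its multiplicative inverse modulo $p$. "Large prime" means $p\ge p_0$ for some absolute constant $p_0$ (independent of $k$ and $N$). -}

module Defs where

open import Data.Fin using (Fin; toℕ; fromℕ<)
open import Data.Fin.Properties using (any?; toℕ-fromℕ<)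
open import Data.Integer using (+_)
open import Data.List using (List; []; _∷_; applyUpTo; cartesianProduct; cartesianProductWith; filter; length)
open import Data.Nat using (ℕ; zero; suc; _+_; _*_; _≟_; NonZero)
open import Data.Nat.Coprimality using (Coprime; coprime-Bézout)
open import Data.Nat.DivMod using (_%_; m%n<n; m%n%n≡m%n; %-distribˡ-*; [m+kn]%n≡m%n)
open import Data.Nat.GCD using (module Bézout)
open import Data.Nat.Primality using (prime?)
open import Data.Nat.Properties using (*-comm)
open import Data.Nat.Solver using (module +-*-Solver)
open import Data.Product using (_×_; _,_; ∃-syntax)
open import Data.Rational as ℚ using (ℚ)
open import Data.Vec as Vec using (Vec)
open import Relation.Binary.PropositionalEquality using (_≡_; refl; sym; trans; cong; module ≡-Reasoning)
open import Relation.Nullary using (Dec; yes; no; contradiction)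

infix 4 _≡_[mod_] _≡?_[mod_]

_≡_[mod_] : ℕ → ℕ → (p : ℕ) → .{{_ : NonZero p}} → Set
a ≡ b [mod p ] = a % p ≡ b % p

_≡?_[mod_] : ∀ a b p .{{_ : NonZero p}} → Dec (a ≡ b [mod p ])
a ≡? b [mod p ] = a % p ≟ b % p

module _ (p : ℕ) .{{_ : NonZero p}} where

  inverse? : ∀ x → Dec (∃[ y ] x * toℕ {p} y ≡ 1 [mod p ])
  inverse? x = any? (λ y → x * toℕ y ≡? 1 [mod p ])

  -- The representative of x* in [0, p); the value 0 for x not coprime to p
  -- is a convention.
  inverse : ℕ → ℕ
  inverse x with inverse? x
  ... | yes (y , _) = toℕ y
  ... | no _        = 0

  private
    reduce : ∀ x z → x * z ≡ 1 [mod p ] → x * (z % p) ≡ 1 [mod p ]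
    reduce x z eq = begin
      (x * (z % p)) % p            ≡⟨ %-distribˡ-* x (z % p) p ⟩
      ((x % p) * (z % p % p)) % p  ≡⟨ cong (λ t → ((x % p) * t) % p) (m%n%n≡m%n z p) ⟩
      ((x % p) * (z % p)) % p      ≡⟨ sym (%-distribˡ-* x z p) ⟩
      (x * z) % p                  ≡⟨ eq ⟩
      1 % p                        ∎
      where open ≡-Reasoning

    -- If 1 + a x = b p, then a (a x) is an inverse of x, as (a x)² ≡ 1.
    square : ∀ x a b → 1 + a * x ≡ b * p → x * (a * (a * x)) ≡ 1 [mod p ]
    square x a b eq = begin
      (x * (a * (a * x))) % p              ≡⟨ sym ([m+kn]%n≡m%n (x * (a * (a * x))) b p) ⟩
      (x * (a * (a * x)) + b * p) % p      ≡⟨ cong (λ t → (x * (a * (a * x)) + t) % p) (sym eq) ⟩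
      (x * (a * (a * x)) + (1 + a * x)) % p ≡⟨ cong (_% p) (rearrange x a) ⟩
      (1 + a * x * (1 + a * x)) % p        ≡⟨ cong (λ t → (1 + a * x * t) % p) eq ⟩
      (1 + a * x * (b * p)) % p            ≡⟨ cong (λ t → (1 + t) % p) (assoc (a * x) b p) ⟩
      (1 + a * x * b * p) % p              ≡⟨ [m+kn]%n≡m%n 1 (a * x * b) p ⟩
      1 % p                                ∎
      where
      open ≡-Reasoning
      open +-*-Solver
      rearrange : ∀ x a → x * (a * (a * x)) + (1 + a * x) ≡ 1 + a * x * (1 + a * x)
      rearrange = solve 2 (λ x a → x :* (a :* (a :* x)) :+ (con 1 :+ a :* x)
                                     := con 1 :+ a :* x :* (con 1 :+ a :* x)) refl
      assoc : ∀ u b q → u * (b * q) ≡ u * b * q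
      assoc = solve 3 (λ u b q → u :* (b :* q) := u :* b :* q) refl

    exists : ∀ x → Coprime x p → ∃[ z ] x * z ≡ 1 [mod p ]
    exists x c with coprime-Bézout c
    ... | Bézout.+- a b eq =
          a , trans (cong (_% p) (trans (*-comm x a) (sym eq))) ([m+kn]%n≡m%n 1 b p)
    ... | Bézout.-+ a b eq = a * (a * x) , square x a b eq

  inverse-correct : ∀ x → Coprime x p → x * inverse x ≡ 1 [mod p ]
  inverse-correct x c with inverse? x
  ... | yes (_ , eq) = eq
  ... | no ¬inv with exists x c
  ...   | z , eq = contradiction
          ( fromℕ< (m%n<n z p)
          , trans (cong (λ t → (x * t) % p) (toℕ-fromℕ< (m%n<n z p))) (reduce x z eq) )
          ¬inv

interval : ℕ → List ℕ
interval N = applyUpTo suc N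

primesIn : ℕ → List ℕ
primesIn N = filter prime? (interval N)

tuples : ∀ {A : Set} (k : ℕ) → List A → List (Vec A k)
tuples zero    xs = Vec.[] ∷ []
tuples (suc k) xs = cartesianProductWith Vec._∷_ xs (tuples k xs)

inverseSum : ∀ (p : ℕ) .{{_ : NonZero p}} {k} → Vec ℕ k → ℕ
inverseSum p xs = Vec.sum (Vec.map (inverse p) xs)

-- A 2k-tuple is split into its first and its last k entries.
solutions : ∀ (p : ℕ) .{{_ : NonZero p}} (k N : ℕ) → List (Vec ℕ k × Vec ℕ k)
solutions p k N =
  filter (λ (xs , ys) → inverseSum p xs ≡? inverseSum p ys [mod p ])
         (cartesianProduct (tuples k (primesIn N)) (tuples k (primesIn N)))

-- The first argument is k, not 2k: J p k N is the J₂ₖ of the congruence mod p.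
J : ∀ (p : ℕ) .{{_ : NonZero p}} (k N : ℕ) → ℕ
J p k N = length (solutions p k N)

fromℕ : ℕ → ℚ
fromℕ n = + n ℚ./ 1

{-# OPTIONS --safe #-}
module Submission where

-- Write E(X)/P(X) for the sum of the reciprocals of the entries of a k-tuple X, with P(X) their product, let
-- n = π(N), and let B = k N^(2k−1), which bounds all E(X) P(Y). A pair (X, Y) is a solution iff
-- E(X) P(Y) − E(Y) P(X) = l p for an integer l, and then |l| ≤ L = ⌊(B − 1)/p⌋.
--
-- If l = 0, every prime occurring in (X, Y) occurs at least twice, since it would otherwise divide exactly
-- one of E(X) P(Y) and E(Y) P(X). So at most k different primes occur, and there are at most (2k)^k (2n)^k / 2 such
-- pairs when k ≤ n.
--
-- If l ≠ 0 and P(Y) ≤ P(X), fix X and put g = gcd(E(X), P(X)). Then g divides l, the value of l determines P(Y)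
-- modulo P(X)/g, and P(Y) determines Y up to k! orderings; so there are at most L k! such Y for each sign of l.
--
-- Together J ≤ (2k)^k (2n)^k / 2 + 4 L k! n^k when k ≤ n. If n² ≤ 2kN, the trivial bound J ≤ n^(2k) suffices.
-- Otherwise k < n, and the bound above suffices because either k = 1 and L = 0, or 2n ≤ N.

open import Defs

module Counting where
  open import Data.Bool using (true; false; if_then_else_)
  open import Data.List using (List; []; _∷_; [_]; _++_; map; length; filter; upTo; cartesianProduct; cartesianProductWith)
  open import Data.List.Membership.DecPropositional using () renaming (_∈?_ to _∈ᵈ?_)
  open import Data.List.Membership.Propositional using (_∈_; _∉_; find; lose)
  open import Data.List.Membership.Propositional.Properties
    using (∈-++⁻; ∈-applyUpTo⁺; ∈-applyUpTo⁻; ∈-upTo⁺; ∈-filter⁻; ∈-cartesianProductWith⁻)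
  open import Data.List.Properties using (applyUpTo-∷ʳ; length-++; length-filter; length-applyUpTo; length-upTo)
  open import Data.List.Relation.Unary.All as All using (All; []; _∷_)
  open import Data.List.Relation.Unary.All.Properties using (all-filter)
  open import Data.List.Relation.Unary.AllPairs using ([]; _∷_)
  open import Data.List.Relation.Unary.Any using (Any; here; there; any?)
  open import Data.List.Relation.Unary.Unique.Propositional using (Unique)
  import Data.List.Relation.Unary.Unique.Propositional.Properties as Unique
  open import Data.Nat
  open import Data.Nat.Coprimality as Coprimality using (Coprime; coprime-/gcd; coprime-divisor; prime⇒coprime)
  open import Data.Nat.Divisibility
  open import Data.Nat.DivMod
  open import Data.Nat.GCD using (gcd; gcd[m,n]∣m; gcd[m,n]∣n; gcd[m,n]≢0)
  open import Data.Nat.ListAction using (sum; product)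
  open import Data.Nat.ListAction.Properties using (∈⇒∣product)
  open import Data.Nat.Primality
    using (Prime; prime?; prime[2]; ¬prime[1]; euclidsLemma; prime⇒irreducible; prime⇒nonZero; productOfPrimes≥1)
  open import Data.Nat.Primality.Factorisation using (factorisationHasAllPrimeFactors)
  open import Data.Nat.Properties
  open import Data.Nat.Tactic.RingSolver using (solve-∀)
  open import Data.Product using (∃; ∃-syntax; _×_; _,_; proj₁)
  open import Data.Sum using (_⊎_; inj₁; inj₂; [_,_]′)
  open import Data.Vec as Vec using (Vec; toList)
  open import Data.Vec.Properties using (length-toList; toList-++)
  open import Function using (_∘_)
  open import Relation.Binary.Definitions using (tri<; tri≈; tri>)
  open import Relation.Binary.PropositionalEquality
    using (_≡_; refl; sym; trans; cong; cong₂; subst; module ≡-Reasoning)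
  open import Relation.Nullary using (Dec; yes; no; ¬_; does; contradiction)
  open import Relation.Nullary.Decidable using (_×-dec_; from-yes)
  open import Relation.Unary using (Pred; Decidable)

  -- Sums over lists and indicators

  ∑ : {A : Set} → List A → (A → ℕ) → ℕ
  ∑ xs f = sum (map f xs)

  𝟙 : {P : Set} → Dec P → ℕ
  𝟙 P? = if does P? then 1 else 0

  𝟙-true : {P : Set} (P? : Dec P) → P → 𝟙 P? ≡ 1
  𝟙-true (yes _) _ = refl
  𝟙-true (no ¬p) p = contradiction p ¬p

  𝟙-false : {P : Set} (P? : Dec P) → ¬ P → 𝟙 P? ≡ 0
  𝟙-false (yes p) ¬p = contradiction p ¬p
  𝟙-false (no _)  _  = refl

  𝟙≤ : {P : Set} (P? : Dec P) {m : ℕ} → (P → 1 ≤ m) → 𝟙 P? ≤ m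
  𝟙≤ (yes p) h = h p
  𝟙≤ (no _)  _ = z≤n

  𝟙-mono : {P Q : Set} (P? : Dec P) (Q? : Dec Q) → (P → Q) → 𝟙 P? ≤ 𝟙 Q?
  𝟙-mono P? Q? f = 𝟙≤ P? (≤-reflexive ∘ sym ∘ 𝟙-true Q? ∘ f)

  module _ {A : Set} where

    ∑-mono : (xs : List A) {f g : A → ℕ} → (∀ {x} → x ∈ xs → f x ≤ g x) → ∑ xs f ≤ ∑ xs g
    ∑-mono []       h = z≤n
    ∑-mono (x ∷ xs) h = +-mono-≤ (h (here refl)) (∑-mono xs (h ∘ there))

    ∑-const : (xs : List A) (c : ℕ) → ∑ xs (λ _ → c) ≡ length xs * c
    ∑-const []       c = refl
    ∑-const (x ∷ xs) c = cong (c +_) (∑-const xs c)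

    ∑-≤ : (xs : List A) {f : A → ℕ} {c : ℕ} → (∀ {x} → x ∈ xs → f x ≤ c) → ∑ xs f ≤ length xs * c
    ∑-≤ xs h = ≤-trans (∑-mono xs h) (≤-reflexive (∑-const xs _))

    ∑-zero : (xs : List A) {f : A → ℕ} → (∀ {x} → x ∈ xs → f x ≡ 0) → ∑ xs f ≡ 0
    ∑-zero []       h = refl
    ∑-zero (x ∷ xs) h = cong₂ _+_ (h (here refl)) (∑-zero xs (h ∘ there))

    ∑-+ : (xs : List A) (f g : A → ℕ) → ∑ xs (λ x → f x + g x) ≡ ∑ xs f + ∑ xs g
    ∑-+ []       f g = refl
    ∑-+ (x ∷ xs) f g = trans (cong (f x + g x +_) (∑-+ xs f g)) (interchange (f x) (g x) (∑ xs f) (∑ xs g))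
      where
      interchange : ∀ a b c d → a + b + (c + d) ≡ a + c + (b + d)
      interchange = solve-∀

    ∑-*ʳ : (xs : List A) (f : A → ℕ) (c : ℕ) → ∑ xs (λ x → f x * c) ≡ ∑ xs f * c
    ∑-*ʳ []       f c = refl
    ∑-*ʳ (x ∷ xs) f c = trans (cong (f x * c +_) (∑-*ʳ xs f c)) (sym (*-distribʳ-+ c (f x) _))

    ∑-++ : (xs ys : List A) (f : A → ℕ) → ∑ (xs ++ ys) f ≡ ∑ xs f + ∑ ys f
    ∑-++ []       ys f = refl
    ∑-++ (x ∷ xs) ys f = trans (cong (f x +_) (∑-++ xs ys f)) (sym (+-assoc (f x) _ _))

    ∈⇒≤∑ : {xs : List A} (f : A → ℕ) {x : A} → x ∈ xs → f x ≤ ∑ xs f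
    ∈⇒≤∑ {xs = y ∷ xs} f (here refl) = m≤m+n (f y) _
    ∈⇒≤∑ {xs = y ∷ xs} f (there i)   = ≤-trans (∈⇒≤∑ f i) (m≤n+m _ (f y))

    length-filter≡∑ : {P : Pred A _} (P? : Decidable P) (xs : List A) → length (filter P? xs) ≡ ∑ xs (λ x → 𝟙 (P? x))
    length-filter≡∑ P? []       = refl
    length-filter≡∑ P? (x ∷ xs) with does (P? x)
    ... | true  = cong suc (length-filter≡∑ P? xs)
    ... | false = length-filter≡∑ P? xs

    -- If nothing is counted, the sum is 0. A bound on a count may therefore fix one counted element
    -- and compare all others with it.
    ∑-𝟙-witness : {P : Pred A _} (P? : Decidable P) (xs : List A) {c : ℕ} →
                  (∀ {x} → x ∈ xs → P x → ∑ xs (λ x → 𝟙 (P? x)) ≤ c) → ∑ xs (λ x → 𝟙 (P? x)) ≤ c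
    ∑-𝟙-witness P? xs h with any? P? xs
    ... | yes any = let x , x∈xs , Px = find any in h x∈xs Px
    ... | no ¬any = ≤-trans (≤-reflexive (∑-zero xs (λ x∈xs → 𝟙-false (P? _) (¬any ∘ lose x∈xs)))) z≤n

  module _ {A B : Set} where

    ∑-map : (xs : List A) (g : A → B) (f : B → ℕ) → ∑ (map g xs) f ≡ ∑ xs (f ∘ g)
    ∑-map []       g f = refl
    ∑-map (x ∷ xs) g f = cong (f (g x) +_) (∑-map xs g f)

    ∑-swap : (xs : List A) (ys : List B) (f : A → B → ℕ) →
             ∑ xs (λ x → ∑ ys (f x)) ≡ ∑ ys (λ y → ∑ xs (λ x → f x y))
    ∑-swap []       ys f = sym (∑-zero ys (λ _ → refl))
    ∑-swap (x ∷ xs) ys f = trans (cong (∑ ys (f x) +_) (∑-swap xs ys f)) (sym (∑-+ ys (f x) _))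

  ∑-cartesianProductWith : {A B C : Set} (g : A → B → C) (xs : List A) (ys : List B) (f : C → ℕ) →
    ∑ (cartesianProductWith g xs ys) f ≡ ∑ xs (λ x → ∑ ys (λ y → f (g x y)))
  ∑-cartesianProductWith g []       ys f = refl
  ∑-cartesianProductWith g (x ∷ xs) ys f =
    trans (∑-++ (map (g x) ys) _ f) (cong₂ _+_ (∑-map ys (g x) f) (∑-cartesianProductWith g xs ys f))

  -- Numbers of distinct values

  infix 4 _∈?_
  _∈?_ : (x : ℕ) (xs : List ℕ) → Dec (x ∈ xs)
  _∈?_ = _∈ᵈ?_ _≟_

  multiplicity : ℕ → List ℕ → ℕ
  multiplicity x ys = ∑ ys (λ y → 𝟙 (x ≟ y))

  ∈⇒multiplicity≥1 : ∀ {x ys} → x ∈ ys → 1 ≤ multiplicity x ys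
  ∈⇒multiplicity≥1 {x} x∈ys = ≤-trans (≤-reflexive (sym (𝟙-true (x ≟ x) refl))) (∈⇒≤∑ _ x∈ys)

  -- Double counting: after the sums are exchanged, each entry of `ys` matches at most one element
  -- of the duplicate-free list `xs`.
  ∑-multiplicity≤length : ∀ {xs} → Unique xs → ∀ ys → ∑ xs (λ x → multiplicity x ys) ≤ length ys
  ∑-multiplicity≤length {xs} xs! ys = begin
    ∑ xs (λ x → ∑ ys (λ y → 𝟙 (x ≟ y))) ≡⟨ ∑-swap xs ys _ ⟩
    ∑ ys (λ y → ∑ xs (λ x → 𝟙 (x ≟ y))) ≤⟨ ∑-≤ ys (λ {y} _ → once xs! y) ⟩
    length ys * 1                       ≡⟨ *-identityʳ _ ⟩
    length ys                           ∎
    where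
    open ≤-Reasoning
    once : ∀ {xs} → Unique xs → ∀ y → ∑ xs (λ x → 𝟙 (x ≟ y)) ≤ 1
    once []                     y = z≤n
    once {x ∷ xs} (x∉xs ∷ xs!) y = cases (x ≟ y)
      where
      cases : Dec (x ≡ y) → ∑ (x ∷ xs) (λ x → 𝟙 (x ≟ y)) ≤ 1
      cases (no x≢y)   = ≤-trans (≤-reflexive (cong (_+ _) (𝟙-false (x ≟ y) x≢y))) (once xs! y)
      cases (yes refl) = ≤-reflexive (cong₂ _+_ (𝟙-true (x ≟ x) refl) (∑-zero xs λ {z} z∈xs →
                           𝟙-false (z ≟ x) (All.lookup x∉xs z∈xs ∘ sym)))

  ∑-∈?≤length : ∀ {xs} → Unique xs → ∀ ys → ∑ xs (λ x → 𝟙 (x ∈? ys)) ≤ length ys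
  ∑-∈?≤length {xs} xs! ys =
    ≤-trans (∑-mono xs (λ {x} _ → 𝟙≤ (x ∈? ys) ∈⇒multiplicity≥1)) (∑-multiplicity≤length xs! ys)

  -- The last occurrence of a value is the one kept, so prepending an entry either leaves the
  -- support of the tail unchanged or extends it by that entry.
  support : List ℕ → List ℕ
  support []       = []
  support (x ∷ xs) with x ∈? xs
  ... | yes _ = support xs
  ... | no _  = x ∷ support xs

  ∈-support⁺ : ∀ {x} xs → x ∈ xs → x ∈ support xs
  ∈-support⁺ (y ∷ xs) x∈ with y ∈? xs
  ∈-support⁺ (y ∷ xs) (here refl) | yes y∈ = ∈-support⁺ xs y∈
  ∈-support⁺ (y ∷ xs) (there x∈)  | yes _  = ∈-support⁺ xs x∈
  ∈-support⁺ (y ∷ xs) (here refl) | no _   = here refl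
  ∈-support⁺ (y ∷ xs) (there x∈)  | no _   = there (∈-support⁺ xs x∈)

  ∈-support⁻ : ∀ {x} xs → x ∈ support xs → x ∈ xs
  ∈-support⁻ (y ∷ xs) x∈ with y ∈? xs
  ∈-support⁻ (y ∷ xs) x∈          | yes _ = there (∈-support⁻ xs x∈)
  ∈-support⁻ (y ∷ xs) (here refl) | no _  = here refl
  ∈-support⁻ (y ∷ xs) (there x∈)  | no _  = there (∈-support⁻ xs x∈)

  support-unique : ∀ xs → Unique (support xs)
  support-unique []       = []
  support-unique (x ∷ xs) with x ∈? xs
  ... | yes _ = support-unique xs
  ... | no x∉ = All.tabulate (λ { y∈ refl → x∉ (∈-support⁻ xs y∈) }) ∷ support-unique xs

  length-support-∷ : ∀ x xs → length (support xs) ≤ length (support (x ∷ xs))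
  length-support-∷ x xs with x ∈? xs
  ... | yes _ = ≤-refl
  ... | no _  = n≤1+n _

  length-support-∉ : ∀ {x xs} → x ∉ xs → length (support (x ∷ xs)) ≡ suc (length (support xs))
  length-support-∉ {x} {xs} x∉xs with x ∈? xs
  ... | yes x∈ = contradiction x∈ x∉xs
  ... | no _   = refl

  -- Used with `m` = 2: if every value is repeated, at most half as many values as entries occur.
  length-support-≤ : ∀ m xs → (∀ {x} → x ∈ xs → m ≤ multiplicity x xs) → length (support xs) * m ≤ length xs
  length-support-≤ m xs h = begin
    length (support xs) * m                       ≡⟨ ∑-const (support xs) m ⟨
    ∑ (support xs) (λ _ → m)                      ≤⟨ ∑-mono (support xs) (h ∘ ∈-support⁻ xs) ⟩
    ∑ (support xs) (λ x → multiplicity x xs)      ≤⟨ ∑-multiplicity≤length (support-unique xs) xs ⟩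
    length xs                                     ∎
    where open ≤-Reasoning

  -- Sums over tuples

  ^-distribʳ-* : ∀ k m n → (m * n) ^ k ≡ m ^ k * n ^ k
  ^-distribʳ-* zero    m n = refl
  ^-distribʳ-* (suc k) m n = trans (cong (m * n *_) (^-distribʳ-* k m n)) (interchange m n (m ^ k) (n ^ k))
    where
    interchange : ∀ a b c d → a * b * (c * d) ≡ a * c * (b * d)
    interchange = solve-∀

  module _ {A : Set} where

    ∑-tuples-suc : ∀ k (xs : List A) (f : Vec A (suc k) → ℕ) →
                   ∑ (tuples (suc k) xs) f ≡ ∑ xs (λ x → ∑ (tuples k xs) (λ t → f (x Vec.∷ t)))
    ∑-tuples-suc k xs f = ∑-cartesianProductWith Vec._∷_ xs (tuples k xs) f

    ∑-cong : (xs : List A) {f g : A → ℕ} → (∀ x → f x ≡ g x) → ∑ xs f ≡ ∑ xs g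
    ∑-cong xs f≡g = ≤-antisym (∑-mono xs (λ _ → ≤-reflexive (f≡g _)))
                              (∑-mono xs (λ _ → ≤-reflexive (sym (f≡g _))))

    -- Lets the two sides of a congruence be counted together, as one tuple of length 2k.
    ∑-tuples-++ : ∀ m n (xs : List A) (f : Vec A (m + n) → ℕ) →
                  ∑ (tuples (m + n) xs) f ≡ ∑ (tuples m xs) (λ u → ∑ (tuples n xs) (λ v → f (u Vec.++ v)))
    ∑-tuples-++ zero    n xs f = sym (+-identityʳ _)
    ∑-tuples-++ (suc m) n xs f =
      trans (∑-tuples-suc (m + n) xs f)
     (trans (∑-cong xs (λ x → ∑-tuples-++ m n xs (f ∘ (x Vec.∷_))))
            (sym (∑-tuples-suc m xs _)))

    length-tuples : ∀ k (xs : List A) → length (tuples k xs) ≡ length xs ^ k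
    length-tuples zero    xs = refl
    length-tuples (suc k) xs = begin
      length (tuples (suc k) xs)               ≡⟨ *-identityʳ _ ⟨
      length (tuples (suc k) xs) * 1           ≡⟨ ∑-const (tuples (suc k) xs) 1 ⟨
      ∑ (tuples (suc k) xs) (λ _ → 1)          ≡⟨ ∑-tuples-suc k xs _ ⟩
      ∑ xs (λ _ → ∑ (tuples k xs) (λ _ → 1))   ≡⟨ ∑-const xs _ ⟩
      length xs * ∑ (tuples k xs) (λ _ → 1)    ≡⟨ cong (length xs *_) (trans (∑-const (tuples k xs) 1) (*-identityʳ _)) ⟩
      length xs * length (tuples k xs)         ≡⟨ cong (length xs *_) (length-tuples k xs) ⟩
      length xs * length xs ^ k                ∎
      where open ≡-Reasoning

    tuples-All : ∀ {P : A → Set} {k xs} {t : Vec A k} → All P xs → t ∈ tuples k xs → All P (toList t)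
    tuples-All {k = zero}  {t = Vec.[]} ps t∈ = []
    tuples-All {k = suc k} {xs}         ps t∈
      with _ , _ , x∈xs , t′∈ , refl ← ∈-cartesianProductWith⁻ Vec._∷_ xs (tuples k xs) t∈
      = All.lookup ps x∈xs ∷ tuples-All ps t′∈

  support-size : ∀ {k} → Vec ℕ k → ℕ
  support-size t = length (support (toList t))

  ∏ : ∀ {k} → Vec ℕ k → ℕ
  ∏ t = product (toList t)

  -- Tuples with few distinct values, and tuples of primes with a given product

  module _ {xs : List ℕ} (xs! : Unique xs) where

    private n = length xs

    -- In terms of Stirling numbers of the second kind this is the sum of S(m, j) n(n - 1)...(n - j
    -- + 1) over j ≤ r.
    few-values : ℕ → ℕ → ℕ
    few-values m r = ∑ (tuples m xs) (λ t → 𝟙 (support-size t ≤? r))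

    few-values-zero : ∀ m → few-values (suc m) 0 ≡ 0
    few-values-zero m = ∑-zero (tuples (suc m) xs) λ {t} _ → 𝟙-false (support-size t ≤? 0) (nonempty t)
      where
      nonempty : ∀ (t : Vec ℕ (suc m)) → support-size t ≰ 0
      nonempty (x Vec.∷ t) ≤0 with support (x ∷ toList t) | ∈-support⁺ (x ∷ toList t) (here refl)
      nonempty (x Vec.∷ t) () | _ ∷ _ | _

    -- The Stirling recurrence as an inequality. A head that occurs in the tail has at most `suc r`
    -- possible values; a new head has at most `n`, and then the tail has at most `r` different
    -- values.
    few-values-suc : ∀ m r → few-values (suc m) (suc r) ≤ few-values m (suc r) * suc r + n * few-values m r
    few-values-suc m r = begin
      few-values (suc m) (suc r)
        ≡⟨ ∑-tuples-suc m xs _ ⟩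
      ∑ xs (λ x → ∑ (tuples m xs) (λ t → 𝟙 (support-size (x Vec.∷ t) ≤? suc r)))
        ≤⟨ ∑-mono xs (λ {x} _ → ∑-mono (tuples m xs) (λ {t} _ → head-old-or-new x t)) ⟩
      ∑ xs (λ x → ∑ (tuples m xs) (λ t → old x t + 𝟙 (support-size t ≤? r)))
        ≡⟨ ∑-cong xs (λ x → ∑-+ (tuples m xs) (old x) _) ⟩
      ∑ xs (λ x → ∑ (tuples m xs) (old x) + few-values m r)
        ≡⟨ ∑-+ xs (λ x → ∑ (tuples m xs) (old x)) (λ _ → few-values m r) ⟩
      ∑ xs (λ x → ∑ (tuples m xs) (old x)) + ∑ xs (λ _ → few-values m r)
        ≡⟨ cong₂ _+_ (∑-swap xs (tuples m xs) old) (∑-const xs _) ⟩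
      ∑ (tuples m xs) (λ t → ∑ xs (λ x → old x t)) + n * few-values m r
        ≤⟨ +-monoˡ-≤ _ (∑-mono (tuples m xs) (λ {t} _ → old-≤ t (support-size t ≤? suc r))) ⟩
      ∑ (tuples m xs) (λ t → 𝟙 (support-size t ≤? suc r) * suc r) + n * few-values m r
        ≡⟨ cong (_+ n * few-values m r) (∑-*ʳ (tuples m xs) _ (suc r)) ⟩
      few-values m (suc r) * suc r + n * few-values m r ∎
      where
      open ≤-Reasoning

      old : ℕ → Vec ℕ m → ℕ
      old x t = 𝟙 (x ∈? support (toList t)) * 𝟙 (support-size t ≤? suc r)

      head-old-or-new : ∀ x t → 𝟙 (support-size (x Vec.∷ t) ≤? suc r) ≤ old x t + 𝟙 (support-size t ≤? r)
      head-old-or-new x t = 𝟙≤ (support-size (x Vec.∷ t) ≤? suc r) (λ le → cases le (x ∈? toList t))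
        where
        cases : support-size (x Vec.∷ t) ≤ suc r → Dec (x ∈ toList t) →
                1 ≤ old x t + 𝟙 (support-size t ≤? r)
        cases le (yes x∈t)
          rewrite 𝟙-true (x ∈? support (toList t)) (∈-support⁺ _ x∈t)
                | 𝟙-true (support-size t ≤? suc r) (≤-trans (length-support-∷ x (toList t)) le) = s≤s z≤n
        cases le (no x∉t)
          rewrite 𝟙-true (support-size t ≤? r) (s≤s⁻¹ (≤-trans (≤-reflexive (sym (length-support-∉ {xs = toList t} x∉t))) le))
          = m≤n+m 1 _

      old-≤ : ∀ t (d : Dec (support-size t ≤ suc r)) →
              ∑ xs (λ x → 𝟙 (x ∈? support (toList t)) * 𝟙 d) ≤ 𝟙 d * suc r
      old-≤ t d = ≤-trans (≤-reflexive (∑-*ʳ xs _ (𝟙 d))) (bound d)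
        where
        bound : ∀ d → ∑ xs (λ x → 𝟙 (x ∈? support (toList t))) * 𝟙 d ≤ 𝟙 d * suc r
        bound (no _)   = ≤-reflexive (*-zeroʳ (∑ xs (λ x → 𝟙 (x ∈? support (toList t)))))
        bound (yes le) = subst (_≤ 1 * suc r) (sym (*-identityʳ _))
          (≤-trans (∑-∈?≤length xs! (support (toList t))) (≤-trans le (≤-reflexive (sym (*-identityˡ _)))))

    -- Each of the m + 1 entries is one of at most k old values or new, and at most r are new; the leading
    -- factor 2 is gained from the rightmost entry, which is always new.
    few-values-≤ : ∀ {k} → k ≤ n → ∀ m r → r ≤ k →
                   2 * few-values (suc m) r * k ^ r ≤ (2 * k) ^ suc m * n ^ r
    few-values-≤ k≤n m zero _ rewrite few-values-zero m = z≤n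
    few-values-≤ {k} k≤n zero (suc r) _ = begin
      2 * few-values 1 (suc r) * (k * k ^ r)  ≤⟨ *-mono-≤ (*-monoʳ-≤ 2 at-most-n) (*-monoʳ-≤ k (^-monoˡ-≤ r k≤n)) ⟩
      2 * n * (k * n ^ r)                     ≡⟨ rearrange k n (n ^ r) ⟩
      (2 * k) ^ 1 * (n * n ^ r)               ∎
      where
      open ≤-Reasoning
      rearrange : ∀ k n z → 2 * n * (k * z) ≡ 2 * k * 1 * (n * z)
      rearrange = solve-∀
      at-most-n : few-values 1 (suc r) ≤ n
      at-most-n = begin
        few-values 1 (suc r)     ≤⟨ ∑-≤ (tuples 1 xs) (λ {t} _ → 𝟙≤ (support-size t ≤? suc r) (λ _ → ≤-refl)) ⟩
        length (tuples 1 xs) * 1 ≡⟨ *-identityʳ _ ⟩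
        length (tuples 1 xs)     ≡⟨ length-tuples 1 xs ⟩
        n * 1                    ≡⟨ *-identityʳ n ⟩
        n                        ∎
    few-values-≤ {k} k≤n (suc m) (suc r) r<k = begin
      2 * few-values (2 + m) (suc r) * (k * k ^ r)
        ≤⟨ *-monoˡ-≤ (k * k ^ r) (*-monoʳ-≤ 2 (few-values-suc (suc m) r)) ⟩
      2 * (a * suc r + n * b) * (k * k ^ r)
        ≤⟨ *-monoˡ-≤ (k * k ^ r) (*-monoʳ-≤ 2 (+-monoˡ-≤ (n * b) (*-monoʳ-≤ a r<k))) ⟩
      2 * (a * k + n * b) * (k * k ^ r)
        ≡⟨ expand a b k n (k ^ r) ⟩
      k * (2 * a * (k * k ^ r)) + n * k * (2 * b * k ^ r)
        ≤⟨ +-mono-≤ (*-monoʳ-≤ k (few-values-≤ k≤n m (suc r) r<k))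
                    (*-monoʳ-≤ (n * k) (few-values-≤ k≤n m r (<⇒≤ r<k))) ⟩
      k * (W * (n * n ^ r)) + n * k * (W * n ^ r)
        ≡⟨ collect k n W (n ^ r) ⟩
      2 * k * W * (n * n ^ r) ∎
      where
      open ≤-Reasoning
      a = few-values (suc m) (suc r)
      b = few-values (suc m) r
      W = (2 * k) ^ suc m
      expand : ∀ a b k n z → 2 * (a * k + n * b) * (k * z) ≡ k * (2 * a * (k * z)) + n * k * (2 * b * z)
      expand = solve-∀
      collect : ∀ k n W z → k * (W * (n * z)) + n * k * (W * z) ≡ 2 * k * W * (n * z)
      collect = solve-∀

    -- At length 2k and r = k, one of the two factors (2k)^k splits as 2^k k^k; its k^k cancels the
    -- one on the left, and its 2^k joins n^k.
    few-values-diagonal : ∀ {k} → 1 ≤ k → k ≤ n → 2 * few-values (k + k) k ≤ (2 * k) ^ k * (2 * n) ^ k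
    few-values-diagonal {k@(suc k′)} _ k≤n = *-cancelʳ-≤ _ _ (k ^ k) (begin
      2 * few-values (k + k) k * k ^ k        ≤⟨ few-values-≤ k≤n (k′ + k) k ≤-refl ⟩
      (2 * k) ^ (k + k) * n ^ k               ≡⟨ cong (_* n ^ k) (^-distribˡ-+-* (2 * k) k k) ⟩
      (2 * k) ^ k * (2 * k) ^ k * n ^ k       ≡⟨ cong (λ z → (2 * k) ^ k * z * n ^ k) (^-distribʳ-* k 2 k) ⟩
      (2 * k) ^ k * (2 ^ k * k ^ k) * n ^ k   ≡⟨ rearrange ((2 * k) ^ k) (2 ^ k) (k ^ k) (n ^ k) ⟩
      (2 * k) ^ k * (2 ^ k * n ^ k) * k ^ k   ≡⟨ cong (λ z → (2 * k) ^ k * z * k ^ k) (^-distribʳ-* k 2 n) ⟨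
      (2 * k) ^ k * (2 * n) ^ k * k ^ k       ∎)
      where
      open ≤-Reasoning
      instance _ = m^n≢0 k k
      rearrange : ∀ a b c d → a * (b * c) * d ≡ a * (b * d) * c
      rearrange = solve-∀

    -- Unique factorisation: fix one tuple `t₀` with product `v`. The head of any other such tuple
    -- is a prime divisor of `v`, hence one of the entries of `t₀`, and cancelling it leaves a
    -- shorter tuple with a determined product.
    factorisations-≤ : All Prime xs → ∀ k v → ∑ (tuples k xs) (λ t → 𝟙 (∏ t ≟ v)) ≤ k !
    factorisations-≤ ps zero    v =
      ≤-trans (≤-reflexive (+-identityʳ _)) (𝟙≤ (1 ≟ v) (λ _ → ≤-refl))
    factorisations-≤ ps (suc k) v = ∑-𝟙-witness (λ t → ∏ t ≟ v) (tuples (suc k) xs) bound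
      where
      open ≤-Reasoning

      extensions : ℕ → ℕ
      extensions x = ∑ (tuples k xs) (λ t → 𝟙 (x * ∏ t ≟ v))

      bound : ∀ {t₀} → t₀ ∈ tuples (suc k) xs → ∏ t₀ ≡ v → ∑ (tuples (suc k) xs) (λ t → 𝟙 (∏ t ≟ v)) ≤ suc k !
      bound {t₀} t₀∈ refl = begin
        ∑ (tuples (suc k) xs) (λ t → 𝟙 (∏ t ≟ v))        ≡⟨ ∑-tuples-suc k xs _ ⟩
        ∑ xs extensions                                  ≤⟨ ∑-mono xs (λ {x} x∈ → head-∈ x x∈ (x ∈? toList t₀)) ⟩
        ∑ xs (λ x → 𝟙 (x ∈? toList t₀) * k !)            ≡⟨ ∑-*ʳ xs _ (k !) ⟩
        ∑ xs (λ x → 𝟙 (x ∈? toList t₀)) * k !            ≤⟨ *-monoˡ-≤ (k !) (∑-∈?≤length xs! (toList t₀)) ⟩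
        length (toList t₀) * k !                         ≡⟨ cong (_* k !) (length-toList t₀) ⟩
        suc k * k !                                      ∎
        where
        head-∈ : ∀ x → x ∈ xs → (d : Dec (x ∈ toList t₀)) → extensions x ≤ 𝟙 d * k !
        head-∈ x x∈ (no x∉t₀) = ≤-reflexive (∑-zero (tuples k xs) λ {t} _ → 𝟙-false (x * ∏ t ≟ v) λ eq →
          x∉t₀ (factorisationHasAllPrimeFactors (All.lookup ps x∈)
                 (subst (x ∣_) eq (m∣m*n (∏ t))) (tuples-All ps t₀∈)))
        head-∈ x x∈ (yes x∈t₀) with divides w v≡wx ← ∈⇒∣product x∈t₀ = begin
          extensions x                              ≤⟨ ∑-mono (tuples k xs) (λ {t} _ → 𝟙-mono (x * ∏ t ≟ v) (∏ t ≟ w)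
                                                         (λ eq → *-cancelˡ-≡ (∏ t) w x (trans eq (trans v≡wx (*-comm w x))))) ⟩
          ∑ (tuples k xs) (λ t → 𝟙 (∏ t ≟ w))       ≤⟨ factorisations-≤ ps k w ⟩
          k !                                       ≡⟨ *-identityˡ (k !) ⟨
          1 * k !                                   ∎
          where instance _ = prime⇒nonZero (All.lookup ps x∈)

  -- Solutions with unequal sums of reciprocals

  module _ {p : ℕ} .{{_ : NonZero p}} where

    +-cong-% : ∀ {a b c d} → a % p ≡ b % p → c % p ≡ d % p → (a + c) % p ≡ (b + d) % p
    +-cong-% {a} {b} {c} {d} a≡b c≡d =
      trans (%-distribˡ-+ a c p) (trans (cong₂ (λ x y → (x + y) % p) a≡b c≡d) (sym (%-distribˡ-+ b d p)))

    *-cong-% : ∀ {a b c d} → a % p ≡ b % p → c % p ≡ d % p → (a * c) % p ≡ (b * d) % p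
    *-cong-% {a} {b} {c} {d} a≡b c≡d =
      trans (%-distribˡ-* a c p) (trans (cong₂ (λ x y → (x * y) % p) a≡b c≡d) (sym (%-distribˡ-* b d p)))

    %≡⇒≡+l*p : ∀ {a b} → b < a → a % p ≡ b % p → ∃[ l ] 1 ≤ l × a ≡ b + l * p
    %≡⇒≡+l*p {a} {b} b<a eq = l , positive l a≡b+lp , a≡b+lp
      where
      l = a / p ∸ b / p
      a≡b+lp : a ≡ b + l * p
      a≡b+lp = begin
        a                                    ≡⟨ m≡m%n+[m/n]*n a p ⟩
        a % p + a / p * p                    ≡⟨ cong₂ (λ x y → x + y * p) eq (sym (m+[n∸m]≡n (/-monoˡ-≤ p (<⇒≤ b<a)))) ⟩
        b % p + (b / p + l) * p              ≡⟨ regroup (b % p) (b / p) l p ⟩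
        b % p + b / p * p + l * p            ≡⟨ cong (_+ l * p) (m≡m%n+[m/n]*n b p) ⟨
        b + l * p                            ∎
        where
        open ≡-Reasoning
        regroup : ∀ r q l p → r + (q + l) * p ≡ r + q * p + l * p
        regroup = solve-∀
      positive : ∀ l → a ≡ b + l * p → 1 ≤ l
      positive zero    eq = contradiction (sym (trans eq (+-identityʳ b))) (<⇒≢ b<a)
      positive (suc l) _  = s≤s z≤n

  module _ {d e : ℕ} .{{_ : NonZero d}} (d⊥e : Coprime d e) where

    -- The equation makes `d` divide `e * (u′ ∸ u)`, hence `u′ ∸ u` by coprimality. Since `u` and
    -- `u′` have the same quotient by `d`, their difference is the zero multiple of `d`.
    block-unique-≤ : ∀ {u u′ s s′} → u ≤ u′ → e * u + s′ * d ≡ e * u′ + s * d → u / d ≡ u′ / d → u ≡ u′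
    block-unique-≤ {u} {u′} {s} {s′} u≤u′ eq same =
      trans (sym (+-identityʳ u)) (trans (cong (λ c → u + c * d) (sym c≡0)) (sym u′≡u+cd))
      where
      w = u′ ∸ u
      d∣ew : d ∣ e * w
      d∣ew = ∣m+n∣m⇒∣n (subst (d ∣_) s′d≡ (n∣m*n s′)) (n∣m*n s)
        where
        regroup : ∀ e u w s d → e * (u + w) + s * d ≡ e * u + (s * d + e * w)
        regroup = solve-∀
        s′d≡ : s′ * d ≡ s * d + e * w
        s′d≡ = +-cancelˡ-≡ (e * u) _ _ (trans eq (trans
                 (cong (λ z → e * z + s * d) (sym (m+[n∸m]≡n u≤u′))) (regroup e u w s d)))
      c : ℕ
      c = quotient (coprime-divisor d⊥e d∣ew)
      u′≡u+cd : u′ ≡ u + c * d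
      u′≡u+cd = trans (sym (m+[n∸m]≡n u≤u′)) (cong (u +_) (_∣_.equality (coprime-divisor d⊥e d∣ew)))
      c≡0 : c ≡ 0
      c≡0 = sym (+-cancelˡ-≡ (u / d) 0 c (begin
        u / d + 0           ≡⟨ +-identityʳ _ ⟩
        u / d               ≡⟨ same ⟩
        u′ / d              ≡⟨ cong (_/ d) u′≡u+cd ⟩
        (u + c * d) / d     ≡⟨ +-distrib-/-∣ʳ u (n∣m*n c) ⟩
        u / d + c * d / d   ≡⟨ cong (u / d +_) (m*n/n≡m c d) ⟩
        u / d + c           ∎))
        where open ≡-Reasoning

    block-unique : ∀ {u u′ s s′} → e * u + s′ * d ≡ e * u′ + s * d → u / d ≡ u′ / d → u ≡ u′
    block-unique {u} {u′} {s} {s′} eq same with ≤-total u u′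
    ... | inj₁ u≤u′ = block-unique-≤ {s = s} {s′} u≤u′ eq same
    ... | inj₂ u′≤u = sym (block-unique-≤ {s = s′} {s} u′≤u (sym eq) (sym same))

  -- `S l t` stands for an equation with difference l p, of either sign, so that one count serves
  -- both. `S-linear` is what remains when l p is eliminated between two tuples with the same `l`
  -- and the common factor `g` is removed.
  module _ {xs : List ℕ} (xs! : Unique xs) (ps : All Prime xs)
           {k : ℕ} {e d g : ℕ} .{{_ : NonZero d}} .{{_ : NonZero g}} (d⊥e : Coprime d e) (c : Vec ℕ k → ℕ)
           {S : ℕ → Vec ℕ k → Set} (S? : ∀ l t → Dec (S l t))
           (S-linear : ∀ {l t t′} → S l t → S l t′ → e * ∏ t + c t′ * d ≡ e * ∏ t′ + c t * d)
           (S⇒g∣ : ∀ {l t} → S l t → g ∣ l)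
           where

    -- A tuple counted here is determined, up to a factorisation of its product v, by l / g and the block
    -- of length d containing v: there are ⌊L/g⌋ values of l / g and g blocks, so the loss of the gcd in
    -- the congruence for v is compensated by the divisibility of l.
    lattice-count : ∀ L → ∑ (tuples k xs) (λ t → 𝟙 (any? (λ l → S? l t) (interval L) ×-dec (∏ t ≤? d * g))) ≤ L * k !
    lattice-count L = begin
      ∑ T (λ t → 𝟙 (any? (λ l → S? l t) (interval L) ×-dec (∏ t ≤? d * g)))
        ≤⟨ ∑-mono T (λ {t} t∈ → 𝟙≤ (any? (λ l → S? l t) (interval L) ×-dec (∏ t ≤? d * g)) (λ (any , ∏t≤) → cover t t∈ any ∏t≤)) ⟩
      ∑ T (λ t → ∑ M (λ μ → ∑ B (λ i → 𝟙 (cell? μ i t))))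
        ≡⟨ ∑-swap T M _ ⟩
      ∑ M (λ μ → ∑ T (λ t → ∑ B (λ i → 𝟙 (cell? μ i t))))
        ≤⟨ ∑-≤ M (λ {μ} _ → row-≤ μ) ⟩
      length M * (length B * k !)
        ≡⟨ cong₂ (λ a b → a * (b * k !)) (length-applyUpTo suc (L / g)) (length-upTo g) ⟩
      L / g * (g * k !)
        ≡⟨ *-assoc (L / g) g (k !) ⟨
      L / g * g * k !
        ≤⟨ *-monoˡ-≤ (k !) (m/n*n≤m L g) ⟩
      L * k ! ∎
      where
      open ≤-Reasoning
      T = tuples k xs
      M = interval (L / g)
      B = upTo g

      -- The shift by 1 turns the range 1 ≤ `∏ t` ≤ `d * g` into exactly `g` full blocks of length
      -- `d`; without it the value `d * g` would open one more block.
      Cell : ℕ → ℕ → Vec ℕ k → Set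
      Cell μ i t = S (μ * g) t × (∏ t ∸ 1) / d ≡ i

      cell? : ∀ μ i t → Dec (Cell μ i t)
      cell? μ i t = S? (μ * g) t ×-dec ((∏ t ∸ 1) / d ≟ i)

      ∏≥1 : ∀ {t} → t ∈ T → 1 ≤ ∏ t
      ∏≥1 t∈ = productOfPrimes≥1 (tuples-All ps t∈)

      cover : ∀ t → t ∈ T → Any (λ l → S l t) (interval L) → ∏ t ≤ d * g → 1 ≤ ∑ M (λ μ → ∑ B (λ i → 𝟙 (cell? μ i t)))
      cover t t∈ any ∏t≤ with find any
      ... | l , l∈ , Slt with ∈-applyUpTo⁻ suc l∈ | S⇒g∣ Slt
      ... | _ , s≤s l≤L , refl | divides (suc μ) l≡ = begin
        1                                                  ≡⟨ 𝟙-true (cell? (suc μ) i t) (subst (λ l → S l t) l≡ Slt , refl) ⟨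
        𝟙 (cell? (suc μ) i t)                              ≤⟨ ∈⇒≤∑ (λ i → 𝟙 (cell? (suc μ) i t)) (∈-upTo⁺ i<g) ⟩
        ∑ B (λ i → 𝟙 (cell? (suc μ) i t))                  ≤⟨ ∈⇒≤∑ (λ μ → ∑ B (λ i → 𝟙 (cell? μ i t))) (∈-applyUpTo⁺ suc μ<) ⟩
        ∑ M (λ μ → ∑ B (λ i → 𝟙 (cell? μ i t)))            ∎
        where
        i = (∏ t ∸ 1) / d
        i<g : i < g
        i<g = m<n*o⇒m/o<n (≤-trans (≤-reflexive (m+[n∸m]≡n (∏≥1 t∈))) (≤-trans ∏t≤ (≤-reflexive (*-comm d g))))
        μ< : suc μ ≤ L / g
        μ< = ≤-trans (≤-reflexive (sym (m*n/n≡m (suc μ) g))) (/-monoˡ-≤ g (≤-trans (≤-reflexive (sym l≡)) (s≤s l≤L)))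

      same-product : ∀ {μ i t t′} → t ∈ T → t′ ∈ T → Cell μ i t → Cell μ i t′ → ∏ t ≡ ∏ t′
      same-product {t = t} {t′} t∈ t′∈ (St , it) (St′ , it′) with ∏ t | ∏ t′ | ∏≥1 t∈ | ∏≥1 t′∈ | S-linear St St′
      -- Cancelling one `e` on each side carries the linear relation from the products to their
      -- predecessors, which are what the blocks see.
      ... | suc u | suc u′ | _ | _ | lin = cong suc (block-unique d⊥e {s = c t} {s′ = c t′} (+-cancelˡ-≡ e _ _
              (trans (shift e u (c t′ * d)) (trans lin (sym (shift e u′ (c t * d)))))) (trans it (sym it′)))
        where
        shift : ∀ e u z → e + (e * u + z) ≡ e * suc u + z
        shift = solve-∀

      cell-≤ : ∀ μ i → ∑ T (λ t → 𝟙 (cell? μ i t)) ≤ k !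
      cell-≤ μ i = ∑-𝟙-witness (cell? μ i) T λ {t₀} t₀∈ Q₀ → begin
        ∑ T (λ t → 𝟙 (cell? μ i t))      ≤⟨ ∑-mono T (λ {t} t∈ → 𝟙-mono (cell? μ i t) (∏ t ≟ ∏ t₀)
                                              (λ Q → same-product {μ} t∈ t₀∈ Q Q₀)) ⟩
        ∑ T (λ t → 𝟙 (∏ t ≟ ∏ t₀))       ≤⟨ factorisations-≤ xs! ps k (∏ t₀) ⟩
        k !                              ∎

      row-≤ : ∀ μ → ∑ T (λ t → ∑ B (λ i → 𝟙 (cell? μ i t))) ≤ length B * k !
      row-≤ μ = ≤-trans (≤-reflexive (∑-swap T B _)) (∑-≤ B (λ {i} _ → cell-≤ μ i))

  -- Clearing denominators

  -- ∑ᵢ ∏_{j ≠ i} xⱼ, so that ∑ᵢ 1/xᵢ = cofactorSum xs / product xs.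
  cofactorSum : List ℕ → ℕ
  cofactorSum []       = 0
  cofactorSum (x ∷ xs) = x * cofactorSum xs + product xs

  prime∣prime⇒≡ : ∀ {p q} → Prime p → Prime q → p ∣ q → p ≡ q
  prime∣prime⇒≡ p-prime q-prime p∣q with prime⇒irreducible q-prime p∣q
  ... | inj₁ refl = contradiction p-prime ¬prime[1]
  ... | inj₂ p≡q  = p≡q

  -- If `q` occurs only once, it divides every term of the cofactor sum except the one that omits
  -- it, and that term is a product of other primes; so `q` must divide `m`.
  ∣cofactorSum⇒repeated : ∀ {q xs} → Prime q → All Prime xs → q ∈ xs → ∀ m → q ∣ cofactorSum xs * m →
             2 ≤ multiplicity q xs ⊎ q ∣ m
  ∣cofactorSum⇒repeated {q} {x ∷ xs} q-prime (x-prime ∷ ps) q∈ m q∣ = cases (q ≟ x) q∈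
    where
    regroup : ∀ x c π m → (x * c + π) * m ≡ x * (c * m) + π * m
    regroup = solve-∀

    q∣′ : q ∣ x * (cofactorSum xs * m) + product xs * m
    q∣′ = subst (q ∣_) (regroup x (cofactorSum xs) (product xs) m) q∣

    cases : Dec (q ≡ x) → q ∈ x ∷ xs → 2 ≤ multiplicity q (x ∷ xs) ⊎ q ∣ m
    cases (yes refl) _ with euclidsLemma (product xs) m q-prime (∣m+n∣m⇒∣n q∣′ (m∣m*n _))
    ... | inj₂ q∣m = inj₂ q∣m
    ... | inj₁ q∣π = inj₁ (+-mono-≤ (≤-reflexive (sym (𝟙-true (q ≟ q) refl)))
                            (∈⇒multiplicity≥1 (factorisationHasAllPrimeFactors q-prime q∣π ps)))
    cases (no q≢x) (here q≡x)  = contradiction q≡x q≢x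
    cases (no q≢x) (there q∈xs)
      with euclidsLemma x _ q-prime (∣m+n∣m⇒∣n (subst (q ∣_) (+-comm _ (product xs * m)) q∣′)
                                              (∣m⇒∣m*n m (∈⇒∣product q∈xs)))
    ... | inj₁ q∣x  = contradiction (prime∣prime⇒≡ q-prime x-prime q∣x) q≢x
    ... | inj₂ q∣cm with ∣cofactorSum⇒repeated q-prime ps q∈xs m q∣cm
    ...   | inj₁ 2≤  = inj₁ (≤-trans 2≤ (m≤n+m _ _))
    ...   | inj₂ q∣m = inj₂ q∣m

  module _ {xs ys : List ℕ} (ps : All Prime xs) (qs : All Prime ys) where

    -- As `q` divides `product xs`, it divides both sides; the left side then forces a second
    -- occurrence in `xs` or an occurrence in `ys`.
    balanced⇒repeated : cofactorSum xs * product ys ≡ cofactorSum ys * product xs →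
                        ∀ {q} → q ∈ xs → 2 ≤ multiplicity q xs + multiplicity q ys
    balanced⇒repeated eq {q} q∈xs with ∣cofactorSum⇒repeated q-prime ps q∈xs (product ys)
                                        (subst (q ∣_) (sym eq) (∣n⇒∣m*n (cofactorSum ys) (∈⇒∣product q∈xs)))
      where q-prime = All.lookup ps q∈xs
    ... | inj₁ 2≤    = ≤-trans 2≤ (m≤m+n _ _)
    ... | inj₂ q∣πys = +-mono-≤ (∈⇒multiplicity≥1 q∈xs)
                                (∈⇒multiplicity≥1 (factorisationHasAllPrimeFactors (All.lookup ps q∈xs) q∣πys qs))

  balanced⇒support-size≤ : ∀ {k} (t u : Vec ℕ k) → All Prime (toList t) → All Prime (toList u) →
    cofactorSum (toList t) * ∏ u ≡ cofactorSum (toList u) * ∏ t → support-size (t Vec.++ u) ≤ k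
  balanced⇒support-size≤ {k} t u ps qs eq = *-cancelʳ-≤ _ _ 2 (begin
    support-size (t Vec.++ u) * 2           ≡⟨ cong (λ z → length (support z) * 2) (toList-++ t u) ⟩
    length (support (xs ++ ys)) * 2         ≤⟨ length-support-≤ 2 (xs ++ ys) twice ⟩
    length (xs ++ ys)                       ≡⟨ length-++ xs ⟩
    length xs + length ys                   ≡⟨ cong₂ _+_ (length-toList t) (length-toList u) ⟩
    k + k                                   ≡⟨ double k ⟩
    k * 2                                   ∎)
    where
    open ≤-Reasoning
    xs = toList t
    ys = toList u
    double : ∀ k → k + k ≡ k * 2
    double = solve-∀
    twice : ∀ {q} → q ∈ xs ++ ys → 2 ≤ multiplicity q (xs ++ ys)
    twice {q} q∈ = ≤-trans ([ balanced⇒repeated ps qs eq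
                            , (λ q∈ys → ≤-trans (balanced⇒repeated qs ps (sym eq) q∈ys)
                                                (≤-reflexive (+-comm (multiplicity q ys) _))) ]′ (∈-++⁻ xs q∈))
                           (≤-reflexive (sym (∑-++ xs ys _)))

  product-≤ : ∀ {N xs} → All (_≤ N) xs → product xs ≤ N ^ length xs
  product-≤ []         = ≤-refl
  product-≤ (x≤ ∷ xs≤) = *-mono-≤ x≤ (product-≤ xs≤)

  -- There is one term for each entry, each with one factor fewer than the full product; the extra
  -- factor `N` on the left avoids the exponent `length xs ∸ 1`.
  cofactorSum-≤ : ∀ {N xs} → All (_≤ N) xs → cofactorSum xs * N ≤ length xs * N ^ length xs
  cofactorSum-≤ []                         = z≤n
  cofactorSum-≤ {N} {x ∷ xs} (x≤ ∷ xs≤) = begin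
    (x * cofactorSum xs + product xs) * N       ≡⟨ regroup x (cofactorSum xs) (product xs) N ⟩
    x * (cofactorSum xs * N) + N * product xs   ≤⟨ +-mono-≤ (*-mono-≤ x≤ (cofactorSum-≤ xs≤)) (*-monoʳ-≤ N (product-≤ xs≤)) ⟩
    N * (length xs * z) + N * z                 ≡⟨ collect N (length xs) z ⟩
    suc (length xs) * (N * z)                   ∎
    where
    open ≤-Reasoning
    z = N ^ length xs
    regroup : ∀ x c π N → (x * c + π) * N ≡ x * (c * N) + N * π
    regroup = solve-∀
    collect : ∀ N l z → N * (l * z) + N * z ≡ suc l * (N * z)
    collect = solve-∀

  cofactorSum≥1 : ∀ {k} (t : Vec ℕ (suc k)) → All Prime (toList t) → 1 ≤ cofactorSum (toList t)
  cofactorSum≥1 (x Vec.∷ t) (_ ∷ ps) = ≤-trans (productOfPrimes≥1 ps) (m≤n+m _ (x * cofactorSum (toList t)))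

  -- From sums of inverses modulo p to congruences between integers

  module _ {p : ℕ} .{{_ : NonZero p}} where

    ∏*inverseSum : ∀ {k} (t : Vec ℕ k) → All (λ x → (x * inverse p x) % p ≡ 1 % p) (toList t) →
                   (∏ t * inverseSum p t) % p ≡ cofactorSum (toList t) % p
    ∏*inverseSum Vec.[]      []         = refl
    ∏*inverseSum (x Vec.∷ t) (inv ∷ is) = begin
      (x * ∏ t * (inverse p x + S)) % p              ≡⟨ %-congˡ (regroup x (∏ t) (inverse p x) S) ⟩
      (x * (∏ t * S) + x * inverse p x * ∏ t) % p    ≡⟨ +-cong-% {a = x * (∏ t * S)} {x * c} (*-cong-% {a = x} {x} refl (∏*inverseSum t is))
                                                                 (*-cong-% {a = x * inverse p x} {1} {∏ t} {∏ t} inv refl) ⟩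
      (x * c + 1 * ∏ t) % p                          ≡⟨ %-congˡ (cong (x * c +_) (*-identityˡ (∏ t))) ⟩
      (x * c + ∏ t) % p                              ∎
      where
      open ≡-Reasoning
      S = inverseSum p t
      c = cofactorSum (toList t)
      regroup : ∀ x π i s → x * π * (i + s) ≡ x * (π * s) + x * i * π
      regroup = solve-∀

    -- Both sides of the congruence are multiplied by `∏ t * ∏ u`.
    inverseSum≡⇒cofactorSum≡ : ∀ {k} (t u : Vec ℕ k) →
      All (λ x → (x * inverse p x) % p ≡ 1 % p) (toList t) →
      All (λ x → (x * inverse p x) % p ≡ 1 % p) (toList u) →
      inverseSum p t % p ≡ inverseSum p u % p →
      (cofactorSum (toList t) * ∏ u) % p ≡ (cofactorSum (toList u) * ∏ t) % p
    inverseSum≡⇒cofactorSum≡ t u is js eq = begin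
      (cofactorSum (toList t) * ∏ u) % p     ≡⟨ *-cong-% {a = ∏ t * inverseSum p t} {c = ∏ u} (∏*inverseSum t is) refl ⟨
      (∏ t * inverseSum p t * ∏ u) % p       ≡⟨ %-congˡ (swap₁ (∏ t) (inverseSum p t) (∏ u)) ⟩
      (∏ t * ∏ u * inverseSum p t) % p       ≡⟨ *-cong-% {a = ∏ t * ∏ u} refl eq ⟩
      (∏ t * ∏ u * inverseSum p u) % p       ≡⟨ %-congˡ (swap₂ (∏ t) (∏ u) (inverseSum p u)) ⟩
      (∏ u * inverseSum p u * ∏ t) % p       ≡⟨ *-cong-% {a = ∏ u * inverseSum p u} {c = ∏ t} (∏*inverseSum u js) refl ⟩
      (cofactorSum (toList u) * ∏ t) % p     ∎
      where
      open ≡-Reasoning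
      swap₁ : ∀ a b c → a * b * c ≡ a * c * b
      swap₁ = solve-∀
      swap₂ : ∀ a b c → a * b * c ≡ b * c * a
      swap₂ = solve-∀

  -- The two kinds of solutions

  π : ℕ → ℕ
  π N = length (primesIn N)

  primesIn-prime : ∀ N → All Prime (primesIn N)
  primesIn-prime N = all-filter prime? (interval N)

  primesIn-≤ : ∀ N → All (_≤ N) (primesIn N)
  primesIn-≤ N = All.tabulate λ x∈ → bound (∈-applyUpTo⁻ suc (proj₁ (∈-filter⁻ prime? {xs = interval N} x∈)))
    where
    bound : ∀ {x} → ∃ (λ i → i < N × x ≡ suc i) → x ≤ N
    bound (_ , i<N , refl) = i<N

  primesIn-unique : ∀ N → Unique (primesIn N)
  primesIn-unique N = Unique.filter⁺ prime? (Unique.applyUpTo⁺₁ suc N (λ i<j _ eq → <⇒≢ i<j (suc-injective eq)))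

  -- This is E(X), and `∏` is P(X).
  coefficient : ∀ {k} → Vec ℕ k → ℕ
  coefficient t = cofactorSum (toList t)

  J≤π^k*π^k : ∀ p .{{_ : NonZero p}} k N → J p k N ≤ π N ^ k * π N ^ k
  J≤π^k*π^k p k N = begin
    J p k N                           ≡⟨ length-filter≡∑ _ (cartesianProduct T T) ⟩
    ∑ (cartesianProduct T T) _        ≡⟨ ∑-cartesianProductWith _,_ T T _ ⟩
    ∑ T (λ t → ∑ T (λ u → 𝟙 (inverseSum p t ≡? inverseSum p u [mod p ])))
      ≤⟨ ∑-≤ T (λ {t} _ → ∑-≤ T (λ {u} _ → 𝟙≤ (inverseSum p t ≡? inverseSum p u [mod p ]) (λ _ → ≤-refl))) ⟩
    length T * (length T * 1)         ≡⟨ cong (length T *_) (*-identityʳ _) ⟩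
    length T * length T               ≡⟨ cong (λ z → z * z) (length-tuples k (primesIn N)) ⟩
    π N ^ k * π N ^ k                 ∎
    where
    open ≤-Reasoning
    T = tuples k (primesIn N)

  module _ {p : ℕ} .{{_ : NonZero p}} (p-prime : Prime p) {N : ℕ} (N<p : N < p) (k′ : ℕ) where

    private
      k = suc k′
      T = tuples k (primesIn N)
      B = k * N ^ (2 * k ∸ 1)
      L = (B ∸ 1) / p

      ∈T⇒prime : ∀ {t} → t ∈ T → All Prime (toList t)
      ∈T⇒prime = tuples-All (primesIn-prime N)

      ∈T⇒≤ : ∀ {t} → t ∈ T → All (_≤ N) (toList t)
      ∈T⇒≤ = tuples-All (primesIn-≤ N)

      ∈T⇒∏≥1 : ∀ {t} → t ∈ T → 1 ≤ ∏ t
      ∈T⇒∏≥1 t∈ = productOfPrimes≥1 (∈T⇒prime t∈)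

      ∈T⇒invertible : ∀ {t} → t ∈ T → All (λ x → (x * inverse p x) % p ≡ 1 % p) (toList t)
      ∈T⇒invertible t∈ = tuples-All (All.zipWith
        (λ {x} (x-prime , x≤N) → inverse-correct p x (Coprimality.sym
          (prime⇒coprime p-prime {{prime⇒nonZero x-prime}} (≤-<-trans x≤N N<p))))
        (primesIn-prime N , primesIn-≤ N)) t∈

      -- If `p` divided the product it would be one of the entries, but these are at most N < p.
      ∏-coprime : ∀ {t} → t ∈ T → Coprime (∏ t) p
      ∏-coprime t∈ (i∣∏ , i∣p) with prime⇒irreducible p-prime i∣p
      ... | inj₁ i≡1  = i≡1
      ... | inj₂ refl = contradiction
              (All.lookup (∈T⇒≤ t∈) (factorisationHasAllPrimeFactors p-prime i∣∏ (∈T⇒prime t∈))) (<⇒≱ N<p)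

      coefficient*∏≤B : ∀ {t u} → t ∈ T → u ∈ T → coefficient t * ∏ u ≤ B
      coefficient*∏≤B {t} {u} t∈ u∈ = cancel N (∈T⇒≤ t∈) (begin
        coefficient t * ∏ u * N                     ≡⟨ regroup (coefficient t) (∏ u) N ⟩
        coefficient t * N * ∏ u                     ≤⟨ *-mono-≤ (cofactorSum-≤ (∈T⇒≤ t∈)) (product-≤ (∈T⇒≤ u∈)) ⟩
        length (toList t) * N ^ length (toList t) * N ^ length (toList u)
          ≡⟨ cong₂ (λ a b → a * N ^ a * N ^ b) (length-toList t) (length-toList u) ⟩
        k * N ^ k * N ^ k                           ≡⟨ *-assoc k (N ^ k) (N ^ k) ⟩
        k * (N ^ k * N ^ k)                         ≡⟨ cong (k *_) (^-distribˡ-+-* N k k) ⟨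
        k * N ^ (k + k)                             ≡⟨ cong (λ z → k * N ^ (k + z)) (+-identityʳ k) ⟨
        -- As `k` is a successor, N^(2k) unfolds by definition to `N * N ^ (2 * k ∸ 1)`.
        k * (N * N ^ (2 * k ∸ 1))                   ≡⟨ regroup′ k N _ ⟩
        B * N                                       ∎)
        where
        open ≤-Reasoning
        regroup : ∀ a b c → a * b * c ≡ a * c * b
        regroup = solve-∀
        regroup′ : ∀ a b c → a * (b * c) ≡ a * c * b
        regroup′ = solve-∀
        cancel : ∀ N {a b} → All (_≤ N) (toList t) → a * N ≤ b * N → a ≤ b
        cancel (suc _) _ a≤b = *-cancelʳ-≤ _ _ _ a≤b
        -- N = 0 would give `∏ t` ≤ 0^k = 0, whereas a product of primes is at least 1.
        cancel zero x≤0 _ = contradiction (product-≤ x≤0) λ ∏≤ →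
          <⇒≱ (∈T⇒∏≥1 t∈) (subst (λ l → ∏ t ≤ 0 ^ l) (length-toList t) ∏≤)

      Excess Deficit : Vec ℕ k → Vec ℕ k → ℕ → Set
      Excess  t u l = coefficient t * ∏ u ≡ coefficient u * ∏ t + l * p
      Deficit t u l = coefficient t * ∏ u + l * p ≡ coefficient u * ∏ t

      excess? : ∀ t l u → Dec (Excess t u l)
      excess? t l u = coefficient t * ∏ u ≟ coefficient u * ∏ t + l * p

      deficit? : ∀ t l u → Dec (Deficit t u l)
      deficit? t l u = coefficient t * ∏ u + l * p ≟ coefficient u * ∏ t

      -- For fixed `t`, `lattice-count` is applied to the reduced form e/d of the fraction E/P,
      -- where P = d g. The relation between two tuples is divided by g; and g, being a divisor of
      -- `∏ t` and so coprime to `p`, divides l because it divides l p.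
      fibre-≤ : ∀ {t} → t ∈ T → {S : ℕ → Vec ℕ k → Set} (S? : ∀ l u → Dec (S l u)) →
        (∀ {l u u′} → S l u → S l u′ → coefficient t * ∏ u + coefficient u′ * ∏ t ≡ coefficient t * ∏ u′ + coefficient u * ∏ t) →
        (∀ {g l u} → g ∣ coefficient t → g ∣ ∏ t → S l u → g ∣ l * p) →
        ∑ T (λ u → 𝟙 (any? (λ l → S? l u) (interval L) ×-dec (∏ u ≤? ∏ t))) ≤ L * k !
      fibre-≤ {t} t∈ {S} S? linear divisible = begin
        ∑ T (λ u → 𝟙 (any? (λ l → S? l u) (interval L) ×-dec (∏ u ≤? ∏ t)))
          ≤⟨ ∑-mono T (λ {u} _ → 𝟙-mono (any? (λ l → S? l u) (interval L) ×-dec (∏ u ≤? ∏ t))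
                                        (any? (λ l → S? l u) (interval L) ×-dec (∏ u ≤? d * g))
                                        (λ (any , ∏u≤) → any , subst (∏ u ≤_) (sym d*g≡) ∏u≤)) ⟩
        ∑ T (λ u → 𝟙 (any? (λ l → S? l u) (interval L) ×-dec (∏ u ≤? d * g)))
          ≤⟨ lattice-count (primesIn-unique N) (primesIn-prime N) {e = e} {d} {g} (Coprimality.sym (coprime-/gcd E P)) coefficient
               S? linear′ g∣l L ⟩
        L * k ! ∎
        where
        open ≤-Reasoning
        E = coefficient t
        P = ∏ t
        g = gcd E P
        instance
          P≢0 : NonZero P
          P≢0 = >-nonZero (∈T⇒∏≥1 t∈)
          g≢0 : NonZero g
          g≢0 = ≢-nonZero (gcd[m,n]≢0 E P (inj₂ (≢-nonZero⁻¹ P)))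
        e = E / g
        d = P / g
        instance
          d≢0 : NonZero d
          d≢0 = >-nonZero (m≥n⇒m/n>0 (∣⇒≤ (gcd[m,n]∣n E P)))
        e*g≡ : e * g ≡ E
        e*g≡ = m/n*n≡m (gcd[m,n]∣m E P)
        d*g≡ : d * g ≡ P
        d*g≡ = m/n*n≡m (gcd[m,n]∣n E P)

        scale : ∀ u u′ → (e * ∏ u + coefficient u′ * d) * g ≡ E * ∏ u + coefficient u′ * P
        scale u u′ = trans (distribute e (∏ u) (coefficient u′) d g)
                           (cong₂ (λ a b → a * ∏ u + coefficient u′ * b) e*g≡ d*g≡)
          where
          distribute : ∀ e v c d g → (e * v + c * d) * g ≡ e * g * v + c * (d * g)
          distribute = solve-∀

        linear′ : ∀ {l u u′} → S l u → S l u′ → e * ∏ u + coefficient u′ * d ≡ e * ∏ u′ + coefficient u * d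
        linear′ {l} {u} {u′} Su Su′ = *-cancelʳ-≡ _ _ g (trans (scale u u′) (trans (linear Su Su′) (sym (scale u′ u))))

        g∣l : ∀ {l u} → S l u → g ∣ l
        g∣l {l} {u} Su = coprime-divisor
          (λ (i∣g , i∣p) → ∏-coprime t∈ (∣-trans i∣g (gcd[m,n]∣n E P) , i∣p))
          (subst (g ∣_) (*-comm l p) (divisible (gcd[m,n]∣m E P) (gcd[m,n]∣n E P) Su))

      -- The first argument is always the tuple with the larger product, the one to be fixed in
      -- `fibre-≤`.
      up down : Vec ℕ k → Vec ℕ k → ℕ
      up   t u = 𝟙 (any? (λ l → excess?  t l u) (interval L) ×-dec (∏ u ≤? ∏ t))
      down t u = 𝟙 (any? (λ l → deficit? t l u) (interval L) ×-dec (∏ u ≤? ∏ t))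

      ∑-up≤ : ∀ {t} → t ∈ T → ∑ T (up t) ≤ L * k !
      ∑-up≤ {t} t∈ = fibre-≤ t∈ (excess? t)
        (λ {l} {u} {u′} Su Su′ → trans (cong (_+ coefficient u′ * ∏ t) Su)
           (trans (regroup (coefficient u * ∏ t) (l * p) (coefficient u′ * ∏ t)) (cong (_+ coefficient u * ∏ t) (sym Su′))))
        (λ {g} {l} {u} g∣E g∣P Su → ∣m+n∣m⇒∣n (subst (g ∣_) Su (∣m⇒∣m*n (∏ u) g∣E)) (∣n⇒∣m*n (coefficient u) g∣P))
        where
        regroup : ∀ a b c → a + b + c ≡ c + b + a
        regroup = solve-∀

      ∑-down≤ : ∀ {t} → t ∈ T → ∑ T (down t) ≤ L * k !
      ∑-down≤ {t} t∈ = fibre-≤ t∈ (deficit? t)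
        (λ {l} {u} {u′} Su Su′ → trans (cong (coefficient t * ∏ u +_) (sym Su′))
           (trans (regroup (coefficient t * ∏ u) (coefficient t * ∏ u′) (l * p)) (cong (coefficient t * ∏ u′ +_) Su)))
        (λ {g} {l} {u} g∣E g∣P Su → ∣m+n∣m⇒∣n (subst (g ∣_) (sym Su) (∣n⇒∣m*n (coefficient u) g∣P)) (∣m⇒∣m*n (∏ u) g∣E))
        where
        regroup : ∀ a b c → a + (b + c) ≡ b + (a + c)
        regroup = solve-∀

      l∈interval : ∀ {t u l} → t ∈ T → u ∈ T → 1 ≤ l → coefficient t * ∏ u ≡ coefficient u * ∏ t + l * p → l ∈ interval L
      l∈interval {t} {u} {suc l} t∈ u∈ _ eq = ∈-applyUpTo⁺ suc (begin
        suc l             ≡⟨ m*n/n≡m (suc l) p ⟨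
        suc l * p / p     ≤⟨ /-monoˡ-≤ p lp≤B∸1 ⟩
        L                 ∎)
        where
        open ≤-Reasoning
        lp≤B∸1 : suc l * p ≤ B ∸ 1
        -- The smaller of the two numbers is at least 1, so their difference is at most B - 1. This
        -- is why `L` is defined with `B ∸ 1`, which in turn makes `L * p` strictly smaller than B.
        lp≤B∸1 = ∸-monoˡ-≤ 1 (begin
          1 + suc l * p                       ≤⟨ +-monoˡ-≤ _ (*-mono-≤ (cofactorSum≥1 u (∈T⇒prime u∈)) (∈T⇒∏≥1 t∈)) ⟩
          coefficient u * ∏ t + suc l * p     ≡⟨ eq ⟨
          coefficient t * ∏ u                 ≤⟨ coefficient*∏≤B t∈ u∈ ⟩
          B                                   ∎)

      balanced : Vec ℕ k → Vec ℕ k → ℕ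
      balanced t u = 𝟙 (support-size (t Vec.++ u) ≤? k)

      -- An excess of `t` over `u` is a deficit of `u` against `t`; the tuple with the larger
      -- product decides which of the two readings is counted.
      excess-counted : ∀ {t u l} → t ∈ T → u ∈ T → 1 ≤ l → Excess t u l → 1 ≤ up t u + down u t
      excess-counted {t} {u} {l} t∈ u∈ 1≤l eq with ≤-total (∏ u) (∏ t)
      ... | inj₁ u≤t = ≤-trans (≤-reflexive (sym (𝟙-true (any? (λ l → excess? t l u) (interval L) ×-dec (∏ u ≤? ∏ t))
                         (lose (l∈interval t∈ u∈ 1≤l eq) eq , u≤t)))) (m≤m+n _ _)
      ... | inj₂ t≤u = ≤-trans (≤-reflexive (sym (𝟙-true (any? (λ l → deficit? u l t) (interval L) ×-dec (∏ t ≤? ∏ u))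
                         (lose (l∈interval t∈ u∈ 1≤l eq) (sym eq) , t≤u)))) (m≤n+m _ (up t u))

      solution-≤ : ∀ {t u} → t ∈ T → u ∈ T →
                   𝟙 (inverseSum p t ≡? inverseSum p u [mod p ]) ≤ balanced t u + (up t u + down t u + (up u t + down u t))
      solution-≤ {t} {u} t∈ u∈ = 𝟙≤ (inverseSum p t ≡? inverseSum p u [mod p ]) λ eq →
        classify (inverseSum≡⇒cofactorSum≡ t u (∈T⇒invertible t∈) (∈T⇒invertible u∈) eq)
        where
        a = coefficient t * ∏ u
        b = coefficient u * ∏ t
        classify : a % p ≡ b % p → 1 ≤ balanced t u + (up t u + down t u + (up u t + down u t))
        classify eq with <-cmp a b
        ... | tri≈ _ a≡b _ = ≤-trans (≤-reflexive (sym (𝟙-true (support-size (t Vec.++ u) ≤? k)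
                               (balanced⇒support-size≤ t u (∈T⇒prime t∈) (∈T⇒prime u∈) a≡b)))) (m≤m+n _ _)
        ... | tri> _ _ b<a = let l , 1≤l , eq′ = %≡⇒≡+l*p b<a eq in
                ≤-trans (excess-counted t∈ u∈ 1≤l eq′)
                  (≤-trans (+-mono-≤ (m≤m+n (up t u) (down t u)) (m≤n+m (down u t) (up u t))) (m≤n+m _ (balanced t u)))
        ... | tri< a<b _ _ = let l , 1≤l , eq′ = %≡⇒≡+l*p a<b (sym eq) in
                ≤-trans (excess-counted u∈ t∈ 1≤l eq′)
                  (≤-trans (≤-reflexive (+-comm (up u t) (down t u)))
                    (≤-trans (+-mono-≤ (m≤n+m (down t u) (up t u)) (m≤m+n (up u t) (down u t))) (m≤n+m _ (balanced t u))))

    -- The factor 4 comes from the sign of the difference and from which of the two tuples has the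
    -- larger product. Exchanging the tuples pairs the four sums, and each is bounded fibre by
    -- fibre.
    J≤balanced+unbalanced :
      J p k N ≤ few-values (primesIn-unique N) (k + k) k + 4 * (π N ^ k * (L * k !))
    J≤balanced+unbalanced = begin
      J p k N
        ≡⟨ length-filter≡∑ _ (cartesianProduct T T) ⟩
      ∑ (cartesianProduct T T) _
        ≡⟨ ∑-cartesianProductWith _,_ T T _ ⟩
      ∑∑ (λ t u → 𝟙 (inverseSum p t ≡? inverseSum p u [mod p ]))
        ≤⟨ ∑-mono T (λ {t} t∈ → ∑-mono T (λ {u} u∈ → solution-≤ t∈ u∈)) ⟩
      ∑∑ (λ t u → balanced t u + (up t u + down t u + (up u t + down u t)))
        ≡⟨ trans (∑∑-+ _ _) (cong (∑∑ balanced +_) (∑∑-+ _ _)) ⟩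
      ∑∑ balanced + (∑∑ (λ t u → up t u + down t u) + ∑∑ (λ t u → up u t + down u t))
        ≡⟨ cong (λ z → ∑∑ balanced + (∑∑ (λ t u → up t u + down t u) + z)) (∑-swap T T (λ t u → up u t + down u t)) ⟩
      ∑∑ balanced + (∑∑ (λ t u → up t u + down t u) + ∑∑ (λ t u → up t u + down t u))
        ≤⟨ +-monoʳ-≤ (∑∑ balanced) (+-mono-≤ unbalanced unbalanced) ⟩
      ∑∑ balanced + (2 * (π N ^ k * (L * k !)) + 2 * (π N ^ k * (L * k !)))
        ≡⟨ cong₂ _+_ (sym (∑-tuples-++ k k (primesIn N) _)) (four (π N ^ k * (L * k !))) ⟩
      few-values (primesIn-unique N) (k + k) k + 4 * (π N ^ k * (L * k !)) ∎
      where
      open ≤-Reasoning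
      ∑∑ : (Vec ℕ k → Vec ℕ k → ℕ) → ℕ
      ∑∑ f = ∑ T (λ t → ∑ T (f t))

      ∑∑-+ : ∀ f g → ∑∑ (λ t u → f t u + g t u) ≡ ∑∑ f + ∑∑ g
      ∑∑-+ f g = trans (∑-cong T (λ t → ∑-+ T (f t) (g t))) (∑-+ T _ _)

      four : ∀ z → 2 * z + 2 * z ≡ 4 * z
      four = solve-∀

      each : ∀ {f} → (∀ {t} → t ∈ T → ∑ T (f t) ≤ L * k !) → ∑∑ f ≤ π N ^ k * (L * k !)
      each h = ≤-trans (∑-≤ T h) (≤-reflexive (cong (_* (L * k !)) (length-tuples k (primesIn N))))

      unbalanced : ∑∑ (λ t u → up t u + down t u) ≤ 2 * (π N ^ k * (L * k !))
      unbalanced = begin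
        ∑∑ (λ t u → up t u + down t u)                        ≡⟨ ∑∑-+ up down ⟩
        ∑∑ up + ∑∑ down                                       ≤⟨ +-mono-≤ (each {up} ∑-up≤) (each {down} ∑-down≤) ⟩
        π N ^ k * (L * k !) + π N ^ k * (L * k !)             ≡⟨ cong (π N ^ k * (L * k !) +_) (+-identityʳ _) ⟨
        2 * (π N ^ k * (L * k !))                             ∎

  -- Prime counting and the final estimate

  π≤ : ∀ N → π N ≤ N
  π≤ N = ≤-trans (length-filter prime? (interval N)) (≤-reflexive (length-applyUpTo suc N))

  π-suc : ∀ N → π (suc N) ≡ π N + 𝟙 (prime? (suc N))
  π-suc N = begin
    π (suc N)                                                ≡⟨ length-filter≡∑ prime? (interval (suc N)) ⟩
    ∑ (interval (suc N)) (λ x → 𝟙 (prime? x))                ≡⟨ cong (λ xs → ∑ xs (λ x → 𝟙 (prime? x))) (sym (applyUpTo-∷ʳ suc N)) ⟩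
    ∑ (interval N ++ [ suc N ]) (λ x → 𝟙 (prime? x))         ≡⟨ ∑-++ (interval N) [ suc N ] _ ⟩
    ∑ (interval N) (λ x → 𝟙 (prime? x)) + (𝟙 (prime? (suc N)) + 0)
      ≡⟨ cong₂ _+_ (sym (length-filter≡∑ prime? (interval N))) (+-identityʳ _) ⟩
    π N + 𝟙 (prime? (suc N))                                 ∎
    where open ≡-Reasoning

  2∣m⊎2∣1+m : ∀ m → 2 ∣ m ⊎ 2 ∣ suc m
  2∣m⊎2∣1+m zero    = inj₁ (2 ∣0)
  2∣m⊎2∣1+m (suc m) with 2∣m⊎2∣1+m m
  ... | inj₁ 2∣m   = inj₂ (∣m∣n⇒∣m+n ∣-refl 2∣m)
  ... | inj₂ 2∣1+m = inj₁ 2∣1+m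

  -- Of the two added integers, both larger than 2, one is even and hence not prime.
  π-step : ∀ {m} → 2 ≤ m → π (2 + m) ≤ suc (π m)
  π-step {m} 2≤m = begin
    π (2 + m)                                              ≡⟨ trans (π-suc (suc m)) (cong (_+ 𝟙 (prime? (2 + m))) (π-suc m)) ⟩
    π m + 𝟙 (prime? (1 + m)) + 𝟙 (prime? (2 + m))          ≡⟨ +-assoc (π m) _ _ ⟩
    π m + (𝟙 (prime? (1 + m)) + 𝟙 (prime? (2 + m)))        ≤⟨ +-monoʳ-≤ (π m) one-even ⟩
    π m + 1                                                ≡⟨ +-comm (π m) 1 ⟩
    suc (π m)                                              ∎
    where
    open ≤-Reasoning
    even>2 : ∀ {x} → 2 < x → 2 ∣ x → 𝟙 (prime? x) ≡ 0
    even>2 {x} 2<x 2∣x = 𝟙-false (prime? x) λ x-prime → <⇒≢ 2<x (prime∣prime⇒≡ prime[2] x-prime 2∣x)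
    𝟙≤1 : ∀ x → 𝟙 (prime? x) ≤ 1
    𝟙≤1 x = 𝟙≤ (prime? x) (λ _ → ≤-refl)
    one-even : 𝟙 (prime? (1 + m)) + 𝟙 (prime? (2 + m)) ≤ 1
    one-even with 2∣m⊎2∣1+m (suc m)
    ... | inj₁ 2∣ = ≤-trans (≤-reflexive (cong (_+ 𝟙 (prime? (2 + m))) (even>2 (s≤s 2≤m) 2∣))) (𝟙≤1 (2 + m))
    ... | inj₂ 2∣ = ≤-trans (≤-reflexive (trans (cong (𝟙 (prime? (1 + m)) +_) (even>2 (m≤n⇒m≤1+n (s≤s 2≤m)) 2∣)) (+-identityʳ _)))
                            (𝟙≤1 (1 + m))

  2π[9+m]≤9+m : ∀ m → 2 * π (9 + m) ≤ 9 + m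
  2π[9+m]≤9+m 0             = from-yes (2 * π 9 ≤? 9)
  2π[9+m]≤9+m 1             = from-yes (2 * π 10 ≤? 10)
  2π[9+m]≤9+m (suc (suc m)) = begin
    2 * π (11 + m)         ≤⟨ *-monoʳ-≤ 2 (π-step {9 + m} (s≤s (s≤s z≤n))) ⟩
    2 * suc (π (9 + m))    ≡⟨ *-suc 2 (π (9 + m)) ⟩
    2 + 2 * π (9 + m)      ≤⟨ +-monoʳ-≤ 2 (2π[9+m]≤9+m m) ⟩
    11 + m                 ∎
    where open ≤-Reasoning

  -- The hypothesis excludes N = 3, 5 and 7, for which 2 π(N) = N + 1.
  4N<π²⇒2π≤N : ∀ N → 4 * N < π N * π N → 2 * π N ≤ N
  4N<π²⇒2π≤N N 4N<π² with 9 ≤? N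
  ... | yes 9≤N = subst (λ N → 2 * π N ≤ N) (m+[n∸m]≡n 9≤N) (2π[9+m]≤9+m (N ∸ 9))
  ... | no 9≰N  = contradiction (small (≰⇒> 9≰N)) (<⇒≱ 4N<π²)
    where
    small : ∀ {N} → N < 9 → π N * π N ≤ 4 * N
    small = from-yes (allUpTo? (λ N → π N * π N ≤? 4 * N) 9)

  -- Elementary estimates and comparison with the stated bound

  suc≤4^ : ∀ k → suc k ≤ 4 ^ k
  suc≤4^ zero    = ≤-refl
  suc≤4^ (suc k) = begin
    2 + k                 ≤⟨ s≤s (suc≤4^ k) ⟩
    1 + 4 ^ k             ≤⟨ +-monoˡ-≤ (4 ^ k) (m^n>0 4 k) ⟩
    4 ^ k + 4 ^ k         ≤⟨ +-monoʳ-≤ (4 ^ k) (m≤m+n (4 ^ k) _) ⟩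
    4 * 4 ^ k             ∎
    where open ≤-Reasoning

  k!≤k^k : ∀ k → k ! ≤ k ^ k
  k!≤k^k zero    = ≤-refl
  k!≤k^k (suc k) = *-monoʳ-≤ (suc k) (≤-trans (k!≤k^k k) (^-monoˡ-≤ k (n≤1+n k)))

  -- Uses 4k ≤ 4^k = 2^k 2^k and k! ≤ k^k: one factor 2^k goes to k^k, the other to n^k.
  4k*k!*n^k≤ : ∀ k′ n → let k = suc k′ in 4 * k * k ! * n ^ k ≤ (2 * k) ^ k * (2 * n) ^ k
  4k*k!*n^k≤ k′ n = begin
    4 * k * k ! * n ^ k               ≤⟨ *-monoˡ-≤ (n ^ k) (*-mono-≤ (*-monoʳ-≤ 4 (suc≤4^ k′)) (k!≤k^k k)) ⟩
    4 ^ k * k ^ k * n ^ k             ≡⟨ cong (λ z → z * k ^ k * n ^ k) (^-distribʳ-* k 2 2) ⟩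
    2 ^ k * 2 ^ k * k ^ k * n ^ k     ≡⟨ regroup (2 ^ k) (k ^ k) (n ^ k) ⟩
    2 ^ k * k ^ k * (2 ^ k * n ^ k)   ≡⟨ cong₂ _*_ (^-distribʳ-* k 2 k) (^-distribʳ-* k 2 n) ⟨
    (2 * k) ^ k * (2 * n) ^ k         ∎
    where
    open ≤-Reasoning
    k = suc k′
    regroup : ∀ a b c → a * a * b * c ≡ a * b * (a * c)
    regroup = solve-∀

  -- Here and below W = (2k)^k, M = N^(2k-1) and Z = N^k. The summand `p` alone gives the weak
  -- inequality, and the positive term `W * M * Z` makes it strict.
  diagonal-bound⇒strict : ∀ {J W M Z p} → J ≤ W * Z → 1 ≤ W → 1 ≤ M → 1 ≤ Z → J * p < W * (M + p) * Z
  diagonal-bound⇒strict {J} {W} {M} {Z} {p} J≤ 1≤W 1≤M 1≤Z = begin-strict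
    J * p                       ≤⟨ *-monoˡ-≤ p J≤ ⟩
    W * Z * p                   <⟨ m<n+m (W * Z * p) (*-mono-≤ (*-mono-≤ 1≤W 1≤M) 1≤Z) ⟩
    W * M * Z + W * Z * p       ≡⟨ regroup W M Z p ⟩
    W * (M + p) * Z             ∎
    where
    open ≤-Reasoning
    regroup : ∀ W M Z p → W * M * Z + W * Z * p ≡ W * (M + p) * Z
    regroup = solve-∀

  -- The balanced solutions `F` are absorbed by the summand `p`, the others by the summand `M`;
  -- strictness comes from `L * p < k * M`.
  unbalanced-bound⇒strict : ∀ {J F W M Z n k f L p} → J ≤ F + 4 * (n * (L * f)) → F ≤ W * Z → L * p < k * M →
    1 ≤ n → 1 ≤ f → 4 * k * f * n ≤ W * Z → J * p < W * (M + p) * Z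
  unbalanced-bound⇒strict {J} {F} {W} {M} {Z} {n} {k} {f} {L} {p} J≤ F≤ Lp< 1≤n 1≤f 4kfn≤ = begin-strict
    J * p                                  ≤⟨ *-monoˡ-≤ p J≤ ⟩
    (F + 4 * (n * (L * f))) * p            ≡⟨ regroup₁ F n L f p ⟩
    F * p + 4 * n * f * (L * p)            <⟨ +-monoʳ-< (F * p) (*-monoʳ-< (4 * n * f) Lp<) ⟩
    F * p + 4 * n * f * (k * M)            ≡⟨ cong (F * p +_) (regroup₂ n f k M) ⟩
    F * p + 4 * k * f * n * M              ≤⟨ +-mono-≤ (*-monoˡ-≤ p F≤) (*-monoˡ-≤ M 4kfn≤) ⟩
    W * Z * p + W * Z * M                  ≡⟨ regroup₃ W Z p M ⟩
    W * (M + p) * Z                        ∎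
    where
    open ≤-Reasoning
    instance _ = >-nonZero {4 * n * f} (*-mono-≤ (*-mono-≤ {1} {4} (s≤s z≤n) 1≤n) 1≤f)
    regroup₁ : ∀ F n L f p → (F + 4 * (n * (L * f))) * p ≡ F * p + 4 * n * f * (L * p)
    regroup₁ = solve-∀
    regroup₂ : ∀ n f k M → 4 * n * f * (k * M) ≡ 4 * k * f * n * M
    regroup₂ = solve-∀
    regroup₃ : ∀ W Z p M → W * Z * p + W * Z * M ≡ W * (M + p) * Z
    regroup₃ = solve-∀

  J*p< : ∀ p .{{_ : NonZero p}} → Prime p → ∀ k N → 1 ≤ k → 1 ≤ N → N < p →
         J p k N * p < (2 * k) ^ k * (N ^ (2 * k ∸ 1) + p) * N ^ k
  J*p< p p-prime k@(suc k′) N _ 1≤N N<p with π N * π N ≤? 2 * k * N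
  ... | yes π²≤ = diagonal-bound⇒strict J≤ (m^n>0 (2 * k) k) (m^n>0 N (2 * k ∸ 1)) (m^n>0 N k)
    where
    open ≤-Reasoning
    instance N≢0 = >-nonZero 1≤N
    J≤ : J p k N ≤ (2 * k) ^ k * N ^ k
    J≤ = begin
      J p k N                     ≤⟨ J≤π^k*π^k p k N ⟩
      π N ^ k * π N ^ k           ≡⟨ ^-distribʳ-* k (π N) (π N) ⟨
      (π N * π N) ^ k             ≤⟨ ^-monoˡ-≤ k π²≤ ⟩
      (2 * k * N) ^ k             ≡⟨ ^-distribʳ-* k (2 * k) N ⟩
      (2 * k) ^ k * N ^ k         ∎
  ... | no π²≰ = cases k′ refl
    where
    open ≤-Reasoning
    instance N≢0 = >-nonZero 1≤N
    n = π N
    W = (2 * k) ^ k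
    F = few-values (primesIn-unique N) (k + k) k
    L = (k * N ^ (2 * k ∸ 1) ∸ 1) / p

    2k<n : 2 * k < n
    -- Cancel N in 2kN < n² ≤ nN.
    2k<n = *-cancelʳ-< N (2 * k) n (≤-trans (≰⇒> π²≰) (*-monoʳ-≤ n (π≤ N)))

    2F≤ : 2 * F ≤ W * (2 * n) ^ k
    2F≤ = few-values-diagonal (primesIn-unique N) (s≤s z≤n) (≤-trans (m≤m+n k _) (<⇒≤ 2k<n))

    cases : ∀ j → k′ ≡ j → J p k N * p < W * (N ^ (2 * k ∸ 1) + p) * N ^ k
    -- For k = 1 the bound B is N < p, so L = 0. The factor 2 gained in `few-values-diagonal` then
    -- gives J ≤ 2n, and n ≤ N is enough.
    cases zero refl = diagonal-bound⇒strict {J = J p 1 N} (*-cancelˡ-≤ 2 (begin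
      2 * J p 1 N                          ≤⟨ *-monoʳ-≤ 2 (J≤balanced+unbalanced p-prime N<p 0) ⟩
      2 * (F + 4 * (n ^ 1 * (L * 1)))      ≡⟨ cong (λ L → 2 * (F + 4 * (n ^ 1 * (L * 1)))) L≡0 ⟩
      2 * (F + 4 * (n ^ 1 * 0))            ≡⟨ cong (λ z → 2 * (F + 4 * z)) (*-zeroʳ (n ^ 1)) ⟩
      2 * (F + 0)                          ≡⟨ cong (2 *_) (+-identityʳ F) ⟩
      2 * F                                ≤⟨ 2F≤ ⟩
      2 * (2 * n) ^ 1                      ≤⟨ *-monoʳ-≤ 2 (^-monoˡ-≤ 1 (*-monoʳ-≤ 2 (π≤ N))) ⟩
      2 * (2 * N) ^ 1                      ≡⟨ cong (2 *_) (^-distribʳ-* 1 2 N) ⟩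
      2 * (2 * N ^ 1)                      ∎)) (m^n>0 2 1) (m^n>0 N 1) (m^n>0 N 1)
      where
      L≡0 : L ≡ 0
      L≡0 = m<n⇒m/n≡0 (≤-<-trans (m∸n≤m _ 1) (≤-<-trans (≤-reflexive (trans (+-identityʳ _) (*-identityʳ N))) N<p))
    -- For k ≥ 2, 4N ≤ 2kN < n² gives 2n ≤ N, so (2n)^k is at most N^k in both the balanced and the
    -- unbalanced contribution.
    cases (suc j) refl = unbalanced-bound⇒strict {W = W} {Z = N ^ k} {n = n ^ k} {k = k} {f = k !} {L = L}
      (J≤balanced+unbalanced p-prime N<p k′)
      (≤-trans (≤-trans (m≤m+n F _) 2F≤) W[2n]^k≤)
      Lp<
      (m^n>0 n {{>-nonZero (≤-trans (s≤s z≤n) 2k<n)}} k)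
      (1≤n! k)
      (≤-trans (4k*k!*n^k≤ k′ n) W[2n]^k≤)
      where
      4N≤2kN : 4 * N ≤ 2 * k * N
      4N≤2kN = *-monoˡ-≤ N (*-monoʳ-≤ 2 {2} {k} (s≤s (s≤s z≤n)))
      W[2n]^k≤ : W * (2 * n) ^ k ≤ W * N ^ k
      W[2n]^k≤ = *-monoʳ-≤ W (^-monoˡ-≤ k (4N<π²⇒2π≤N N (≤-<-trans 4N≤2kN (≰⇒> π²≰))))
      Lp< : L * p < k * N ^ (2 * k ∸ 1)
      Lp< = ≤-<-trans (m/n*n≤m _ p) (≤-reflexive (m+[n∸m]≡n {1} (*-mono-≤ {1} {k} (s≤s z≤n) (m^n>0 N (2 * k ∸ 1)))))

-- Passage to the inequality between rationals

module Rationals where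
  open import Data.Integer as ℤ using (+_)
  import Data.Integer.Properties as ℤ
  open import Data.Nat as ℕ using (ℕ; suc)
  open import Data.Nat.Tactic.RingSolver using (solve-∀)
  open import Data.Rational
  open import Data.Rational.Properties using (toℚᵘ-cancel-<; toℚᵘ-fromℚᵘ; toℚᵘ-homo-+; toℚᵘ-homo-*)
  open import Data.Rational.Unnormalised as ℚᵘ using (mkℚᵘ; *<*)
  import Data.Rational.Unnormalised.Properties as ℚᵘ
  open import Relation.Binary.PropositionalEquality using (_≡_; sym; trans; cong; cong₂; subst₂)

  -- In unnormalised rationals sums and products compute without reduction to lowest terms, so the
  -- inequality becomes a cross-multiplied one between integers.
  clear-denominator : ∀ a b c d q → a ℕ.* suc q ℕ.< b ℕ.* (c ℕ.+ suc q) ℕ.* d →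
                      fromℕ a < fromℕ b * (+ c / suc q + 1ℚ) * fromℕ d
  clear-denominator a b c d q a<b = toℚᵘ-cancel-< (begin-strict
    toℚᵘ (fromℕ a)                                                      ≃⟨ toℚᵘ-fromℚᵘ (mkℚᵘ (+ a) 0) ⟩
    mkℚᵘ (+ a) 0                                                        <⟨ *<* integer ⟩
    mkℚᵘ (+ b) 0 ℚᵘ.* (mkℚᵘ (+ c) q ℚᵘ.+ ℚᵘ.1ℚᵘ) ℚᵘ.* mkℚᵘ (+ d) 0
      ≃⟨ ℚᵘ.*-cong (ℚᵘ.*-cong (toℚᵘ-fromℚᵘ (mkℚᵘ (+ b) 0)) (ℚᵘ.+-congˡ ℚᵘ.1ℚᵘ (toℚᵘ-fromℚᵘ (mkℚᵘ (+ c) q))))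
                   (toℚᵘ-fromℚᵘ (mkℚᵘ (+ d) 0)) ⟨
    toℚᵘ (fromℕ b) ℚᵘ.* (toℚᵘ (+ c / suc q) ℚᵘ.+ toℚᵘ 1ℚ) ℚᵘ.* toℚᵘ (fromℕ d)
      ≃⟨ ℚᵘ.*-congʳ {toℚᵘ (fromℕ d)} (ℚᵘ.*-congˡ {toℚᵘ (fromℕ b)} (toℚᵘ-homo-+ (+ c / suc q) 1ℚ)) ⟨
    toℚᵘ (fromℕ b) ℚᵘ.* toℚᵘ (+ c / suc q + 1ℚ) ℚᵘ.* toℚᵘ (fromℕ d)
      ≃⟨ ℚᵘ.*-congʳ {toℚᵘ (fromℕ d)} (toℚᵘ-homo-* (fromℕ b) (+ c / suc q + 1ℚ)) ⟨
    toℚᵘ (fromℕ b * (+ c / suc q + 1ℚ)) ℚᵘ.* toℚᵘ (fromℕ d)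
      ≃⟨ toℚᵘ-homo-* (fromℕ b * (+ c / suc q + 1ℚ)) (fromℕ d) ⟨
    toℚᵘ (fromℕ b * (+ c / suc q + 1ℚ) * fromℕ d)                       ∎)
    where
    open ℚᵘ.≤-Reasoning

    -- The left side is the form to which the denominator of the unnormalised right-hand side
    -- evaluates.
    denominator : ∀ q → (q ℕ.* 1 ℕ.+ 0) ℕ.* 1 ≡ q
    denominator = solve-∀

    numerator : (+ b ℤ.* (+ c ℤ.* + 1 ℤ.+ + 1 ℤ.* + suc q) ℤ.* + d) ℤ.* + 1 ≡ + (b ℕ.* (c ℕ.+ suc q) ℕ.* d)
    numerator = trans (ℤ.*-identityʳ _) (trans
      (cong (λ z → + b ℤ.* z ℤ.* + d) (cong₂ ℤ._+_ (ℤ.*-identityʳ (+ c)) (ℤ.*-identityˡ (+ suc q))))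
      (trans (cong (ℤ._* + d) (sym (ℤ.pos-* b (c ℕ.+ suc q)))) (sym (ℤ.pos-* (b ℕ.* (c ℕ.+ suc q)) d))))

    integer : + a ℤ.* ℚᵘ.↧ (mkℚᵘ (+ b) 0 ℚᵘ.* (mkℚᵘ (+ c) q ℚᵘ.+ ℚᵘ.1ℚᵘ) ℚᵘ.* mkℚᵘ (+ d) 0)
              ℤ.< ℚᵘ.↥ (mkℚᵘ (+ b) 0 ℚᵘ.* (mkℚᵘ (+ c) q ℚᵘ.+ ℚᵘ.1ℚᵘ) ℚᵘ.* mkℚᵘ (+ d) 0) ℤ.* + 1
    integer = subst₂ ℤ._<_
      (trans (ℤ.pos-* a (suc q)) (cong (λ z → + a ℤ.* + z) (sym (denominator (suc q)))))
      (sym numerator)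
      (ℤ.+<+ a<b)

open import Data.Integer using (+_)
open import Data.Nat using (ℕ; _≤_; _<_; _∸_; _^_; NonZero; suc) renaming (_*_ to _*ℕ_)
open import Data.Nat.Primality using (Prime)
open import Data.Product using (∃-syntax; _,_)
open import Data.Rational using (_/_; _+_; _*_; 1ℚ) renaming (_<_ to _<ℚ_)

theorem6 : ∃[ p₀ ] ∀ (p : ℕ) .{{_ : NonZero p}} → Prime p → p₀ ≤ p →
    ∀ (k N : ℕ) → 1 ≤ k → 1 ≤ N → N < p →
    fromℕ (J p k N) <ℚ
    fromℕ ((2 *ℕ k) ^ k) * (+ (N ^ (2 *ℕ k ∸ 1)) / p + 1ℚ) * fromℕ (N ^ k)
theorem6 = 0 , λ where
  -- Matching `p` as a successor gives the denominator the form used by `clear-denominator`.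
  p@(suc q) p-prime _ k N 1≤k 1≤N N<p →
    Rationals.clear-denominator (J p k N) ((2 *ℕ k) ^ k) (N ^ (2 *ℕ k ∸ 1)) (N ^ k) q
      (Counting.J*p< p p-prime k N 1≤k 1≤N N<p)
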